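{- For every natural number $m\ge 1$, every linear order $(L,\prec)$ that is $m$-dimensionally interpretable in $(\mathbb{N},+)$ has $VD_*$-rank at most $m$.
   Context: A linear order $(L,\prec)$ is $m$-dimensionally interpretable in $(\mathbb{N},+)$ if there are first-order formulas $D(\bar x)$, $E(\bar x,\bar y)$, $R(\bar x,\bar y)$ over the signature $\{=,+\}$ (without parameters; $\bar x,\bar y$ tuples of $m$ variables) such that $D$ defines a nonempty set $D^*\subseteq\mathbb{N}^m$, $E$ defines an equivalence relation $\sim$ on $D^*$, and there is a bijection $h:D^*/{\sim}\to L$ with $h([\bar a])\prec h([\bar b])$ iff $(\mathbb{N},+)\models R(\bar a,\bar b)$ for all $\bar a,\bar b\in D^*$. For a linear order $(L,\prec)$ define equivalence relations $\simeq_\alpha$ on $L$ for ordinals $\alpha$: $\simeq_0$ is equality; $\simeq_\lambda=\bigcup_{\beta<\lambda}\simeq_\beta$ for limit $\lambda$; $a\simeq_{\alpha+1}b$ iff the set $\{c\in L\mid a\prec c\prec b\text{ or }b\prec c\prec a\}/{\simeq_\alpha}$ is finite. The $VD_*$-rank of $(L,\prec)$ is the least ordinal $\alpha$ such that $L/{\simeq_\alpha}$ is finite, and is $\infty$ (greater than all ordinals) if no such $\alpha$ exists. -}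

module Defs where

open import Level using (Level; _⊔_; Lift)
open import Data.Nat using (ℕ; zero; suc; _+_; _≤_)
open import Data.Fin using (Fin)
open import Data.Vec using (Vec; _∷_; lookup; _++_)
open import Data.List using (List)
open import Data.List.Relation.Unary.All using (All)
open import Data.List.Relation.Unary.Any using (Any)
open import Data.Product using (Σ; ∃; _×_)
open import Data.Sum using (_⊎_)
open import Data.Unit.Polymorphic using (⊤)
open import Data.Empty using (⊥)
open import Relation.Binary.Core using (Rel)
open import Relation.Binary.PropositionalEquality using (_≡_)
open import Function.Bundles using (_⇔_)

data Term (n : ℕ) : Set where
  var  : Fin n → Term n
  _⊕_  : Term n → Term n → Term n

data Formula (n : ℕ) : Set where
  _≐_   : Term n → Term n → Formula n
  ¬'_   : Formula n → Formula n
  _∧'_  : Formula n → Formula n → Formula n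
  _∨'_  : Formula n → Formula n → Formula n
  _⇒'_  : Formula n → Formula n → Formula n
  ∀'_   : Formula (suc n) → Formula n
  ∃'_   : Formula (suc n) → Formula n

⟦_⟧ : ∀ {n} → Term n → Vec ℕ n → ℕ
⟦ var i ⟧ ρ = lookup ρ i
⟦ s ⊕ t ⟧ ρ = ⟦ s ⟧ ρ + ⟦ t ⟧ ρ

Sat : ∀ {n} → Formula n → Vec ℕ n → Set
Sat (s ≐ t)  ρ = ⟦ s ⟧ ρ ≡ ⟦ t ⟧ ρ
Sat (¬' φ)   ρ = Sat φ ρ → ⊥
Sat (φ ∧' ψ) ρ = Sat φ ρ × Sat ψ ρ
Sat (φ ∨' ψ) ρ = Sat φ ρ ⊎ Sat ψ ρ
Sat (φ ⇒' ψ) ρ = Sat φ ρ → Sat ψ ρ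
Sat (∀' φ)   ρ = (a : ℕ) → Sat φ (a ∷ ρ)
Sat (∃' φ)   ρ = Σ ℕ (λ a → Sat φ (a ∷ ρ))

-- m-dimensional interpretation of (L, ≺) in (ℕ, +).
-- E(x̄,ȳ), R(x̄,ȳ) have 2m free variables: x̄ first, then ȳ.
-- h is a map D* → L (it may depend on the membership proof, but h-≡
-- forces it to be constant on ∼-classes); together with h-≡ and
-- h-surj it is exactly a bijection D*/∼ → L.

record Interpretation {ℓ ℓ'} (L : Set ℓ) (_≺_ : Rel L ℓ') (m : ℕ)
       : Set (ℓ ⊔ ℓ') where
  field
    D : Formula m
    E : Formula (m + m)
    R : Formula (m + m)
    D-nonempty : ∃ λ (a : Vec ℕ m) → Sat D a
    E-refl  : ∀ a → Sat D a → Sat E (a ++ a)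
    E-sym   : ∀ a b → Sat D a → Sat D b → Sat E (a ++ b) → Sat E (b ++ a)
    E-trans : ∀ a b c → Sat D a → Sat D b → Sat D c →
              Sat E (a ++ b) → Sat E (b ++ c) → Sat E (a ++ c)
    h       : (a : Vec ℕ m) → Sat D a → L
    h-surj  : ∀ (x : L) → ∃ λ (a : Vec ℕ m) → Σ (Sat D a) (λ d → h a d ≡ x)
    h-≡     : ∀ a b (da : Sat D a) (db : Sat D b) →
              (h a da ≡ h b db) ⇔ Sat E (a ++ b)
    h-≺     : ∀ a b (da : Sat D a) (db : Sat D b) →
              (h a da ≺ h b db) ⇔ Sat R (a ++ b)

module _ {ℓ ℓ'} {L : Set ℓ} (_≺_ : Rel L ℓ') where

  FiniteMod : ∀ {p r} → (L → Set p) → Rel L r → Set (ℓ ⊔ p ⊔ r)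
  FiniteMod P _≈_ = ∃ λ (xs : List L) → All P xs × (∀ c → P c → Any (c ≈_) xs)

  StrictlyBetween : L → L → L → Set ℓ'
  StrictlyBetween a b c = (a ≺ c × c ≺ b) ⊎ (b ≺ c × c ≺ a)

  VDEquiv : ℕ → Rel L (ℓ ⊔ ℓ')
  VDEquiv zero    a b = Lift (ℓ ⊔ ℓ') (a ≡ b)
  VDEquiv (suc k) a b = FiniteMod (StrictlyBetween a b) (VDEquiv k)

  VDRankAtMost : ℕ → Set (ℓ ⊔ ℓ')
  VDRankAtMost m = ∃ λ k → k ≤ m × FiniteMod (λ (_ : L) → ⊤ {ℓ}) (VDEquiv k)

{-# OPTIONS --safe #-}
module Submission where

-- Satisfaction of a formula at ρ depends only on the signs of the affine forms with small coefficients at ρ and on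
-- ρ modulo some M. This Ehrenfeucht–Fraïssé form of quantifier elimination makes satisfaction decidable, and
-- φ(x, ρ) periodic in x beyond a bound linear in ∣ρ∣. All relations ≃ₖ are definable, as "finite" means "covered by
-- elements of bounded norm". If an interval (a, b) has infinitely many ≃ₖ-classes, then by periodicity
-- its elements of norm O(N + ∣a∣ + ∣b∣) meet at least N of them; inductively, the intervals between consecutive
-- representatives contain Nᵏ elements of norm O(N + ∣a∣ + ∣b∣) each, so (a, b) contains N^(k+1). If L / ≃ₘ were
-- infinite, L would in the same way have N^(m+1) elements of norm O(N), but there are only O(Nᵐ) such tuples.

open import Defs
open import Level using (Level; _⊔_; lift)
open import Data.Nat as ℕ using (ℕ; zero; suc; _+_; _*_; _^_; _≤_; _<_; s≤s; z≤n; NonZero; _!)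
import Data.Nat.Properties as ℕₚ
import Data.Nat.Divisibility as Div
import Data.Nat.Tactic.RingSolver as ℕ-Solver
open import Data.Nat.Induction using (<-wellFounded; Acc; acc)
open import Data.Integer as ℤ using (ℤ; +_; -[1+_]; 0ℤ; ∣_∣)
import Data.Integer.Properties as ℤₚ
open import Data.Integer.Tactic.RingSolver using (solve-∀)
open import Data.Fin as Fin using (Fin; zero; suc)
import Data.Fin.Properties as Finₚ
open import Data.Vec as Vec using (Vec; []; _∷_; lookup; _++_; take; drop; head; tail; sum)
import Data.Vec.Properties as Vecₚ
open import Data.Vec.Relation.Unary.All as VecAll using ([]; _∷_)
open import Data.List as List using (List; []; _∷_; upTo; cartesianProductWith)
import Data.List.Properties as Listₚ
open import Data.List.Relation.Unary.All as All using (All; []; _∷_)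
import Data.List.Relation.Unary.All.Properties as Allₚ
open import Data.List.Relation.Unary.Any as Any using (Any; here; there; satisfied)
import Data.List.Relation.Unary.Any.Properties as Anyₚ
open import Data.List.Relation.Unary.AllPairs as AllPairs using (AllPairs; []; _∷_)
import Data.List.Relation.Unary.AllPairs.Properties as AllPairsₚ
open import Data.List.Relation.Unary.Linked.Properties using (Linked⇒AllPairs)
open import Data.List.Relation.Binary.Permutation.Propositional using (_↭_; ↭-sym; ↭⇒↭ₛ)
open import Data.List.Relation.Binary.Permutation.Propositional.Properties using (↭-length; All-resp-↭)
open import Data.List.Relation.Binary.Permutation.Setoid.Properties using (AllPairs-resp-↭)
import Data.List.Sort
open import Data.List.Membership.Propositional using (_∈_; find; lose)
import Data.List.Membership.Propositional.Properties as ∈ₚ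
open import Data.Product as Product using (Σ; ∃; ∃₂; _×_; _,_; proj₁; proj₂)
open import Data.Sum as Sum using (_⊎_; inj₁; inj₂)
open import Function using (_∘_; _⇔_; mk⇔; Equivalence)
open import Relation.Nullary using (Dec; yes; no; ¬_; _×-dec_; _⊎-dec_; _→-dec_; ¬?; contradiction)
open import Relation.Nullary.Decidable using (map′; decidable-stable)
open import Relation.Binary.Bundles using (DecTotalOrder)
import Relation.Binary.Construct.On as On
import Relation.Binary.Properties.StrictTotalOrder as StrictTotalOrderₚ
open import Relation.Binary.Core using (Rel)
open import Relation.Binary.Definitions using (Tri; tri<; tri≈; tri>)
open import Relation.Binary.Structures using (IsStrictTotalOrder)
open import Relation.Binary.PropositionalEquality

private variable
  n k m : ℕ

≤⇒+ : ∀ {i j} → i ≤ j → ∃ λ k → j ≡ k + i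
≤⇒+ i≤j = _ , sym (ℕₚ.m∸n+n≡m i≤j)

-- Affine forms and the equivalence of tuples

dot : Vec ℤ n → Vec ℕ n → ℤ
dot []       []       = 0ℤ
dot (c ∷ cs) (x ∷ xs) = c ℤ.* + x ℤ.+ dot cs xs

infixr 7 _·_
infixl 6 _⊞_

_·_ : ℤ → Vec ℤ n → Vec ℤ n
s · c = Vec.map (s ℤ.*_) c

_⊞_ : Vec ℤ n → Vec ℤ n → Vec ℤ n
_⊞_ = Vec.zipWith ℤ._+_

Bounded : ℕ → Vec ℤ n → Set
Bounded K = VecAll.All (λ z → ∣ z ∣ ≤ K)

dot-⊞ : (c d : Vec ℤ n) (ρ : Vec ℕ n) → dot (c ⊞ d) ρ ≡ dot c ρ ℤ.+ dot d ρ
dot-⊞ []      []      []      = refl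
dot-⊞ (c ∷ cs) (d ∷ ds) (x ∷ ρ) rewrite dot-⊞ cs ds ρ = lemma c d (+ x) (dot cs ρ) (dot ds ρ)
  where
  lemma : ∀ c d x u v →
    (c ℤ.+ d) ℤ.* x ℤ.+ (u ℤ.+ v) ≡ (c ℤ.* x ℤ.+ u) ℤ.+ (d ℤ.* x ℤ.+ v)
  lemma = solve-∀

dot-· : (s : ℤ) (c : Vec ℤ n) (ρ : Vec ℕ n) → dot (s · c) ρ ≡ s ℤ.* dot c ρ
dot-· s []       []      = sym (ℤₚ.*-zeroʳ s)
dot-· s (c ∷ cs) (x ∷ ρ) rewrite dot-· s cs ρ = lemma s c (+ x) (dot cs ρ)
  where
  lemma : ∀ s c x u → s ℤ.* c ℤ.* x ℤ.+ s ℤ.* u ≡ s ℤ.* (c ℤ.* x ℤ.+ u)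
  lemma = solve-∀

zeros : Vec ℤ n
zeros = Vec.replicate _ 0ℤ

dot-zeros : (ρ : Vec ℕ n) → dot zeros ρ ≡ 0ℤ
dot-zeros []      = refl
dot-zeros (x ∷ ρ) rewrite dot-zeros ρ = refl

bounded-zeros : ∀ {K} → Bounded K (zeros {n})
bounded-zeros {zero}  = []
bounded-zeros {suc n} = z≤n ∷ bounded-zeros

bounded-mono : ∀ {K K′} {c : Vec ℤ n} → K ≤ K′ → Bounded K c → Bounded K′ c
bounded-mono K≤K′ = VecAll.map (λ z≤K → ℕₚ.≤-trans z≤K K≤K′)

∣*∣-bound : ∀ {A B} i j → ∣ i ∣ ≤ A → ∣ j ∣ ≤ B → ∣ i ℤ.* j ∣ ≤ A * B
∣*∣-bound i j p q = subst (_≤ _) (sym (ℤₚ.∣i*j∣≡∣i∣*∣j∣ i j)) (ℕₚ.*-mono-≤ p q)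

∣+∣-bound : ∀ {A B} i j → ∣ i ∣ ≤ A → ∣ j ∣ ≤ B → ∣ i ℤ.+ j ∣ ≤ A + B
∣+∣-bound i j p q = ℕₚ.≤-trans (ℤₚ.∣i+j∣≤∣i∣+∣j∣ i j) (ℕₚ.+-mono-≤ p q)

bounded-· : ∀ {A B s} {c : Vec ℤ n} → ∣ s ∣ ≤ A → Bounded B c → Bounded (A * B) (s · c)
bounded-· p []       = []
bounded-· {s = s} {c ∷ _} p (q ∷ qs) = ∣*∣-bound s c p q ∷ bounded-· {s = s} p qs

bounded-⊞ : ∀ {A B} {c d : Vec ℤ n} → Bounded A c → Bounded B d → Bounded (A + B) (c ⊞ d)
bounded-⊞ []       []       = []
bounded-⊞ {c = c ∷ _} {d ∷ _} (p ∷ ps) (q ∷ qs) = ∣+∣-bound c d p q ∷ bounded-⊞ ps qs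

∣dot∣-bound : ∀ {K} {c : Vec ℤ n} (ρ : Vec ℕ n) → Bounded K c → ∣ dot c ρ ∣ ≤ K * sum ρ
∣dot∣-bound []      []       = z≤n
∣dot∣-bound {K = K} {c = c ∷ cs} (x ∷ ρ) (p ∷ ps) = subst (∣ dot (c ∷ cs) (x ∷ ρ) ∣ ≤_) (sym (ℕₚ.*-distribˡ-+ K x (sum ρ)))
  (∣+∣-bound (c ℤ.* + x) (dot cs ρ) (∣*∣-bound c (+ x) p ℕₚ.≤-refl) (∣dot∣-bound ρ ps))

coefficientBound : (c : Vec ℤ n) → ∃ λ K → Bounded K c
coefficientBound []       = 0 , []
coefficientBound (c ∷ cs) with K , ps ← coefficientBound cs =
  _ , ℕₚ.m≤m+n (∣ c ∣) K ∷ bounded-mono (ℕₚ.m≤n+m K (∣ c ∣)) ps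

-- One-sided, and not symmetric by itself: the negation of 0 ≤ f is 0 ≤ - f - 1, whose constant term
-- may exceed K. `Sim` therefore asks for both directions.
_⊢_≲_ : ℕ → Vec ℕ n → Vec ℕ n → Set
K ⊢ ρ ≲ σ = ∀ c₀ c → ∣ c₀ ∣ ≤ K → Bounded K c → 0ℤ ℤ.≤ c₀ ℤ.+ dot c ρ → 0ℤ ℤ.≤ c₀ ℤ.+ dot c σ

-- Entrywise congruence, phrased through all integer forms. In this shape it pulls back along linear
-- maps, and it hands `transfer` the quotient q for the form at hand.
_≡_mod_ : Vec ℕ n → Vec ℕ n → ℕ → Set
ρ ≡ σ mod M = ∀ c → ∃ λ q → dot c σ ≡ dot c ρ ℤ.+ + M ℤ.* q

record Sim (K M : ℕ) (ρ σ : Vec ℕ n) : Set where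
  constructor sim
  field
    ≲ : K ⊢ ρ ≲ σ
    ≳ : K ⊢ σ ≲ ρ
    ≡-mod : ρ ≡ σ mod M

mod-sym : ∀ {M} {ρ σ : Vec ℕ n} → ρ ≡ σ mod M → σ ≡ ρ mod M
mod-sym {M = M} {ρ} ρ≡σ c with q , eq ← ρ≡σ c = ℤ.- q ,
  trans (lemma (dot c ρ) (+ M) q) (cong (ℤ._+ + M ℤ.* ℤ.- q) (sym eq))
  where
  lemma : ∀ u M q → u ≡ u ℤ.+ M ℤ.* q ℤ.+ M ℤ.* ℤ.- q
  lemma = solve-∀

mod-trans : ∀ {M} {ρ σ τ : Vec ℕ n} → ρ ≡ σ mod M → σ ≡ τ mod M → ρ ≡ τ mod M
mod-trans {M = M} {ρ} ρ≡σ σ≡τ c with q , eq ← ρ≡σ c | r , eq′ ← σ≡τ c = q ℤ.+ r ,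
  trans eq′ (trans (cong (ℤ._+ + M ℤ.* r) eq) (lemma (dot c ρ) (+ M) q r))
  where
  lemma : ∀ u M q r → u ℤ.+ M ℤ.* q ℤ.+ M ℤ.* r ≡ u ℤ.+ M ℤ.* (q ℤ.+ r)
  lemma = solve-∀

mod-∣ : ∀ {M N} {ρ σ : Vec ℕ n} → M Div.∣ N → ρ ≡ σ mod N → ρ ≡ σ mod M
mod-∣ {M = M} {ρ = ρ} (Div.divides t refl) ρ≡σ c with q , eq ← ρ≡σ c = + t ℤ.* q ,
  trans eq (trans (cong (λ z → dot c ρ ℤ.+ z ℤ.* q) (ℤₚ.pos-* t M)) (lemma (dot c ρ) (+ M) (+ t) q))
  where
  lemma : ∀ u M t q → u ℤ.+ t ℤ.* M ℤ.* q ≡ u ℤ.+ M ℤ.* (t ℤ.* q)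
  lemma = solve-∀

Sim-refl : ∀ {K M} {ρ : Vec ℕ n} → Sim K M ρ ρ
Sim-refl {M = M} {ρ} = sim (λ _ _ _ _ p → p) (λ _ _ _ _ p → p)
  λ c → 0ℤ , sym (trans (cong (ℤ._+_ (dot c ρ)) (ℤₚ.*-zeroʳ (+ M))) (ℤₚ.+-identityʳ _))

Sim-sym : ∀ {K M} {ρ σ : Vec ℕ n} → Sim K M ρ σ → Sim K M σ ρ
Sim-sym {M = M} (sim f g h) = sim g f (mod-sym {M = M} h)

Sim-trans : ∀ {K M} {ρ σ τ : Vec ℕ n} → Sim K M ρ σ → Sim K M σ τ → Sim K M ρ τ
Sim-trans {M = M} (sim f g h) (sim f′ g′ h′) = sim
  (λ c₀ c p q → f′ c₀ c p q ∘ f c₀ c p q) (λ c₀ c p q → g c₀ c p q ∘ g′ c₀ c p q) (mod-trans {M = M} h h′)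

≲-mono : ∀ {K K′} {ρ σ : Vec ℕ n} → K ≤ K′ → K′ ⊢ ρ ≲ σ → K ⊢ ρ ≲ σ
≲-mono K≤ f c₀ c p q = f c₀ c (ℕₚ.≤-trans p K≤) (bounded-mono K≤ q)

Sim-mono : ∀ {K K′ M M′} {ρ σ : Vec ℕ n} → K ≤ K′ → M Div.∣ M′ → Sim K′ M′ ρ σ → Sim K M ρ σ
Sim-mono K≤ M∣ (sim f g h) = sim (≲-mono K≤ f) (≲-mono K≤ g) (mod-∣ M∣ h)

mod-shift : ∀ {M} x y {q} (ρ : Vec ℕ n) → + y ≡ + x ℤ.+ + M ℤ.* q → (x ∷ ρ) ≡ (y ∷ ρ) mod M
mod-shift {M = M} x y {q} ρ eq (c ∷ cs) = c ℤ.* q ,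
  trans (cong (λ z → c ℤ.* z ℤ.+ dot cs ρ) eq) (lemma c (+ x) (+ M) q (dot cs ρ))
  where
  lemma : ∀ c x M q u → c ℤ.* (x ℤ.+ M ℤ.* q) ℤ.+ u ≡ c ℤ.* x ℤ.+ u ℤ.+ M ℤ.* (c ℤ.* q)
  lemma = solve-∀

-- Finite search over coefficients and elimination of one variable

vectors : ∀ {a} {A : Set a} → List A → ∀ n → List (Vec A n)
vectors xs zero    = [] ∷ []
vectors xs (suc n) = cartesianProductWith _∷_ xs (vectors xs n)

∈-vectors : ∀ {a} {A : Set a} {xs : List A} {v : Vec A n} → VecAll.All (_∈ xs) v → v ∈ vectors xs n
∈-vectors []       = here refl
∈-vectors (p ∷ ps) = ∈ₚ.∈-cartesianProductWith⁺ _∷_ p (∈-vectors ps)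

integers : ℕ → List ℤ
integers K = List.map +_ (upTo (suc K)) List.++ List.map (λ z → ℤ.- + z) (upTo (suc K))

∈-integers : ∀ {K} z → ∣ z ∣ ≤ K → z ∈ integers K
∈-integers (+ z)      p = ∈ₚ.∈-++⁺ˡ (∈ₚ.∈-map⁺ +_ (∈ₚ.∈-upTo⁺ (s≤s p)))
∈-integers {K} -[1+ z ] p = ∈ₚ.∈-++⁺ʳ (List.map +_ (upTo (suc K))) (∈ₚ.∈-map⁺ (λ z → ℤ.- + z) (∈ₚ.∈-upTo⁺ (s≤s p)))

integers-bounded : ∀ {K z} → z ∈ integers K → ∣ z ∣ ≤ K
integers-bounded {K} z∈ with ∈ₚ.∈-++⁻ (List.map +_ (upTo (suc K))) z∈
... | inj₁ p with x , x∈ , refl ← ∈ₚ.∈-map⁻ +_ p = ℕₚ.≤-pred (∈ₚ.∈-upTo⁻ x∈)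
... | inj₂ p with x , x∈ , refl ← ∈ₚ.∈-map⁻ (λ z → ℤ.- + z) p =
  subst (_≤ K) (sym (ℤₚ.∣-i∣≡∣i∣ (+ x))) (ℕₚ.≤-pred (∈ₚ.∈-upTo⁻ x∈))

vectors-All : ∀ {a} {A : Set a} {xs : List A} {n} {v : Vec A n} → v ∈ vectors xs n → VecAll.All (_∈ xs) v
vectors-All {xs = xs} {n = zero}  {[]} (here refl) = []
vectors-All {xs = xs} {n = suc n} v∈
  with _ , _ , a∈ , w∈ , refl ← ∈ₚ.∈-cartesianProductWith⁻ _∷_ xs (vectors xs n) v∈ = a∈ ∷ vectors-All w∈

-- Only finitely many coefficient vectors are bounded by K. This replaces excluded middle in
-- `descend`: either all forms agree, or one that does not is found.
bounded-search : ∀ {p} {P : Vec ℤ n → Set p} (K : ℕ) → (∀ c → Dec (P c)) →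
  (∀ c → Bounded K c → P c) ⊎ (∃ λ c → Bounded K c × ¬ P c)
bounded-search {n} K P? with All.all? P? (vectors (integers K) n)
... | yes all = inj₁ λ c b → All.lookup all (∈-vectors (VecAll.map (λ {z} → ∈-integers z) b))
... | no ¬all with c , c∈ , ¬p ← find (Allₚ.¬All⇒Any¬ P? _ ¬all) =
  inj₂ (c , VecAll.map integers-bounded (vectors-All c∈) , ¬p)

-- The candidates of quantifier elimination: x is, up to the error e, the zero of a form with a
-- nonzero coefficient at x. The error has its own bound E because it grows with the modulus.
Near : ℕ → ℕ → ℕ → Vec ℕ n → Set
Near K E x ρ = ∃ λ a → ∃ λ e → ∃ λ c →
  suc a ≤ K × ∣ e ∣ ≤ E × Bounded K c × + suc a ℤ.* + x ≡ e ℤ.+ dot c ρ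

-- Let s be the small value of the form. Solving for b * x gives the error s - c₀, hence the bound T
-- + K; for negative b the whole equation is negated.
near : ∀ {K T} x (ρ : Vec ℕ n) c₀ b c → ∣ c₀ ∣ ≤ K → b ≢ 0ℤ → ∣ b ∣ ≤ K → Bounded K c →
  ∣ c₀ ℤ.+ dot (b ∷ c) (x ∷ ρ) ∣ ≤ T → Near K (T + K) x ρ
near x ρ c₀ (+ zero) c p b≢0 q r t = contradiction refl b≢0
near {K = K} {T} x ρ c₀ (+ suc a) c p b≢0 q r t = a , s ℤ.+ ℤ.- c₀ , -1c , q ,
  ∣+∣-bound s (ℤ.- c₀) t (subst (_≤ _) (sym (ℤₚ.∣-i∣≡∣i∣ c₀)) p) ,
  subst (λ B → Bounded B -1c) (ℕₚ.*-identityˡ K) (bounded-· {A = 1} {s = ℤ.- ℤ.1ℤ} ℕₚ.≤-refl r) ,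
  trans (lemma (+ suc a) (+ x) c₀ (dot c ρ)) (cong (ℤ._+_ (s ℤ.+ ℤ.- c₀)) (sym (dot-· (ℤ.- ℤ.1ℤ) c ρ)))
  where
  -1c = (ℤ.- ℤ.1ℤ) · c
  s = c₀ ℤ.+ dot (+ suc a ∷ c) (x ∷ ρ)
  lemma : ∀ a x c u → a ℤ.* x ≡ c ℤ.+ (a ℤ.* x ℤ.+ u) ℤ.+ ℤ.- c ℤ.+ ℤ.- ℤ.1ℤ ℤ.* u
  lemma = solve-∀
near {K = K} {T} x ρ c₀ -[1+ a ] c p b≢0 q r t = a , ℤ.- s ℤ.+ c₀ , c , q ,
  ∣+∣-bound (ℤ.- s) c₀ (subst (_≤ _) (sym (ℤₚ.∣-i∣≡∣i∣ s)) t) p , r ,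
  lemma (+ suc a) (+ x) c₀ (dot c ρ)
  where
  s = c₀ ℤ.+ dot (-[1+ a ] ∷ c) (x ∷ ρ)
  lemma : ∀ a x c u → a ℤ.* x ≡ ℤ.- (c ℤ.+ (ℤ.- a ℤ.* x ℤ.+ u)) ℤ.+ c ℤ.+ u
  lemma = solve-∀

-- The sign test changes from s to t, so zero separates them or is one of them.
straddle : ∀ s t → 0ℤ ℤ.≤ s × ¬ 0ℤ ℤ.≤ t ⊎ ¬ 0ℤ ℤ.≤ s × 0ℤ ℤ.≤ t → ∣ s ∣ ≤ ∣ s ℤ.- t ∣
straddle (+ s)      (+ t)      (inj₁ (_ , ¬t)) = contradiction (ℤ.+≤+ z≤n) ¬t
straddle (+ s)      -[1+ t ]   _               = ℕₚ.m≤m+n s (suc t)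
straddle (+ s)      (+ t)      (inj₂ (¬s , _)) = contradiction (ℤ.+≤+ z≤n) ¬s
straddle -[1+ s ]   (+ zero)   _               = ℕₚ.≤-refl
straddle -[1+ s ]   (+ suc t)  _               = s≤s (ℕₚ.m≤n⇒m≤1+n (ℕₚ.m≤m+n s t))
straddle -[1+ s ]   -[1+ t ]   (inj₂ (_ , ()))

-- Subtract M from x as long as no form changes its sign: the first change puts x near a zero of that form.
descend : ∀ {K M} → 1 ≤ K → .{{NonZero M}} → (ρ : Vec ℕ n) (x : ℕ) →
  ∃ λ y → Near K (K * M + K) y ρ × Sim K M (x ∷ ρ) (y ∷ ρ)
descend {n} {K} {M} 1≤K ρ x = go x (<-wellFounded x)
  where
  Agree : ℕ → Vec ℤ (suc (suc n)) → Set
  Agree y (c₀ ∷ c) = (0ℤ ℤ.≤ c₀ ℤ.+ dot c (y + M ∷ ρ) → 0ℤ ℤ.≤ c₀ ℤ.+ dot c (y ∷ ρ))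
                   × (0ℤ ℤ.≤ c₀ ℤ.+ dot c (y ∷ ρ) → 0ℤ ℤ.≤ c₀ ℤ.+ dot c (y + M ∷ ρ))
  nonneg? : ∀ z → Dec (0ℤ ℤ.≤ z)
  nonneg? z = 0ℤ ℤ.≤? z
  agree? : ∀ y c → Dec (Agree y c)
  agree? y (c₀ ∷ c) = (nonneg? _ →-dec nonneg? _) ×-dec (nonneg? _ →-dec nonneg? _)

  opposite : ∀ {s t} → ¬ ((0ℤ ℤ.≤ s → 0ℤ ℤ.≤ t) × (0ℤ ℤ.≤ t → 0ℤ ℤ.≤ s)) →
    0ℤ ℤ.≤ s × ¬ 0ℤ ℤ.≤ t ⊎ ¬ 0ℤ ℤ.≤ s × 0ℤ ℤ.≤ t
  opposite {s} {t} ¬⇔ with nonneg? s | nonneg? t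
  ... | yes p | yes q = contradiction ((λ _ → q) , (λ _ → p)) ¬⇔
  ... | yes p | no ¬q = inj₁ (p , ¬q)
  ... | no ¬p | yes q = inj₂ (¬p , q)
  ... | no ¬p | no ¬q = contradiction ((λ p → contradiction p ¬p) , (λ q → contradiction q ¬q)) ¬⇔

  disagree : ∀ y c → Bounded K c → ¬ Agree y c → Near K (K * M + K) (y + M) ρ
  disagree y (c₀ ∷ b ∷ c) (p ∷ q ∷ r) ¬agree = near (y + M) ρ c₀ b c p b≢0 q r s≤
    where
    s = c₀ ℤ.+ dot (b ∷ c) (y + M ∷ ρ)
    t = c₀ ℤ.+ dot (b ∷ c) (y ∷ ρ)
    lemma : ∀ c b y M u → c ℤ.+ (b ℤ.* (y ℤ.+ M) ℤ.+ u) ℤ.- (c ℤ.+ (b ℤ.* y ℤ.+ u)) ≡ b ℤ.* M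
    lemma = solve-∀
    s-t : s ℤ.- t ≡ b ℤ.* + M
    s-t = trans (cong (λ z → c₀ ℤ.+ (b ℤ.* z ℤ.+ dot c ρ) ℤ.- t) (ℤₚ.pos-+ y M)) (lemma c₀ b (+ y) (+ M) (dot c ρ))
    s≤ : ∣ s ∣ ≤ K * M
    s≤ = ℕₚ.≤-trans (straddle s t (opposite ¬agree))
           (subst (λ z → ∣ z ∣ ≤ K * M) (sym s-t) (∣*∣-bound b (+ M) q ℕₚ.≤-refl))
    -- With b = 0 the form would not see the passage from y + M to y.
    b≢0 : b ≢ 0ℤ
    b≢0 refl = ¬agree (subst (0ℤ ℤ.≤_) s≡t , subst (0ℤ ℤ.≤_) (sym s≡t))
      where
      s≡t : s ≡ t
      s≡t = ℤₚ.i-j≡0⇒i≡j s t s-t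

  go : ∀ x → Acc _<_ x → ∃ λ y → Near K (K * M + K) y ρ × Sim K M (x ∷ ρ) (y ∷ ρ)
  go x (acc rec) with x ℕ.<? M
  -- No further subtraction is possible, but now the form x itself has a value below M.
  ... | yes x<M = x , near x ρ 0ℤ ℤ.1ℤ zeros z≤n (λ ()) 1≤K bounded-zeros (subst (λ z → ∣ z ∣ ≤ K * M) (sym simp)
           (ℕₚ.≤-trans (ℕₚ.<⇒≤ x<M) (ℕₚ.m≤n*m M K {{ℕ.>-nonZero 1≤K}}))) , Sim-refl
    where
    simp : 0ℤ ℤ.+ dot (ℤ.1ℤ ∷ zeros) (x ∷ ρ) ≡ + x
    simp rewrite dot-zeros ρ = trans (ℤₚ.+-identityˡ _) (trans (ℤₚ.+-identityʳ _) (ℤₚ.*-identityˡ (+ x)))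
  ... | no x≮M with y , refl ← ≤⇒+ (ℕₚ.≮⇒≥ x≮M) with bounded-search K (agree? y)
  ...   | inj₂ (c , bc , ¬agree) = y + M , disagree y c bc ¬agree , Sim-refl
  ...   | inj₁ agree with z , nz , y∼z ← go y (rec (ℕₚ.m<m+n y (ℕ.>-nonZero⁻¹ M))) = z , nz ,
          Sim-trans (sim (λ c₀ c p q → proj₁ (agree (c₀ ∷ c) (p ∷ q))) (λ c₀ c p q → proj₂ (agree (c₀ ∷ c) (p ∷ q)))
            (mod-shift {M = M} (y + M) y {ℤ.- ℤ.1ℤ} ρ (trans (lemma (+ y) (+ M)) (cong (ℤ._+ + M ℤ.* ℤ.- ℤ.1ℤ) (sym (ℤₚ.pos-+ y M)))))) y∼z
    where
    lemma : ∀ y M → y ≡ y ℤ.+ M ℤ.+ M ℤ.* ℤ.- ℤ.1ℤ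
    lemma = solve-∀

-- Since a x = e + c·ρ and a y = e + c·σ, multiplying by a turns a form in x ∷ ρ into one in ρ.
≲-extend : ∀ {K E} (ρ σ : Vec ℕ n) (x y a : ℕ) e c → suc a ≤ K → ∣ e ∣ ≤ E → Bounded K c →
  K ≤ E → (K * K + K * E) ⊢ ρ ≲ σ →
  + suc a ℤ.* + x ≡ e ℤ.+ dot c ρ → + suc a ℤ.* + y ≡ e ℤ.+ dot c σ →
  K ⊢ x ∷ ρ ≲ (y ∷ σ)
≲-extend {K = K} {E} ρ σ x y a e c a≤ e≤ c≤ K≤E ρ≲σ eqx eqy b₀ (b ∷ bs) p (q ∷ r) 0≤ =
  ℤₚ.*-cancelˡ-≤-pos 0ℤ _ (+ suc a) (subst₂ ℤ._≤_ (sym (ℤₚ.*-zeroʳ (+ suc a))) (sym (identity y σ eqy)) (ρ≲σ d₀ d d₀≤ d≤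
    (subst₂ ℤ._≤_ (ℤₚ.*-zeroʳ (+ suc a)) (identity x ρ eqx) (ℤₚ.*-monoˡ-≤-nonNeg (+ suc a) 0≤))))
  where
  d₀ = + suc a ℤ.* b₀ ℤ.+ b ℤ.* e
  d = (+ suc a · bs) ⊞ (b · c)
  d₀≤ : ∣ d₀ ∣ ≤ K * K + K * E
  d₀≤ = ∣+∣-bound (+ suc a ℤ.* b₀) (b ℤ.* e) (∣*∣-bound (+ suc a) b₀ a≤ p) (∣*∣-bound b e q e≤)
  d≤ : Bounded (K * K + K * E) d
  d≤ = bounded-mono (ℕₚ.+-monoʳ-≤ (K * K) (ℕₚ.*-monoʳ-≤ K K≤E))
         (bounded-⊞ (bounded-· {s = + suc a} a≤ r) (bounded-· {s = b} q c≤))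
  lemma₁ : ∀ a b₀ b z v → a ℤ.* (b₀ ℤ.+ (b ℤ.* z ℤ.+ v)) ≡ a ℤ.* b₀ ℤ.+ b ℤ.* (a ℤ.* z) ℤ.+ a ℤ.* v
  lemma₁ = solve-∀
  lemma₂ : ∀ a b₀ b v e u → a ℤ.* b₀ ℤ.+ b ℤ.* (e ℤ.+ u) ℤ.+ a ℤ.* v ≡ a ℤ.* b₀ ℤ.+ b ℤ.* e ℤ.+ (a ℤ.* v ℤ.+ b ℤ.* u)
  lemma₂ = solve-∀
  identity : ∀ z τ → + suc a ℤ.* + z ≡ e ℤ.+ dot c τ → + suc a ℤ.* (b₀ ℤ.+ dot (b ∷ bs) (z ∷ τ)) ≡ d₀ ℤ.+ dot d τ
  identity z τ eq = begin
    + suc a ℤ.* (b₀ ℤ.+ (b ℤ.* + z ℤ.+ dot bs τ))                          ≡⟨ lemma₁ (+ suc a) b₀ b (+ z) (dot bs τ) ⟩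
    + suc a ℤ.* b₀ ℤ.+ b ℤ.* (+ suc a ℤ.* + z) ℤ.+ + suc a ℤ.* dot bs τ    ≡⟨ cong (λ w → + suc a ℤ.* b₀ ℤ.+ b ℤ.* w ℤ.+ + suc a ℤ.* dot bs τ) eq ⟩
    + suc a ℤ.* b₀ ℤ.+ b ℤ.* (e ℤ.+ dot c τ) ℤ.+ + suc a ℤ.* dot bs τ      ≡⟨ lemma₂ (+ suc a) b₀ b (dot bs τ) e (dot c τ) ⟩
    d₀ ℤ.+ (+ suc a ℤ.* dot bs τ ℤ.+ b ℤ.* dot c τ)                        ≡⟨ cong (ℤ._+_ d₀) (cong₂ ℤ._+_ (dot-· (+ suc a) bs τ) (dot-· b c τ)) ⟨
    d₀ ℤ.+ (dot (+ suc a · bs) τ ℤ.+ dot (b · c) τ)                        ≡⟨ cong (ℤ._+_ d₀) (dot-⊞ (+ suc a · bs) (b · c) τ) ⟨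
    d₀ ℤ.+ dot d τ                                                         ∎
    where open ≡-Reasoning

factor : ∀ {a K} → suc a ≤ K → suc a Div.∣ K !
factor {a} a≤K = Div.∣-trans (Div.m∣m*n (a !)) (Div.m≤n⇒m!∣n! a≤K)

-- The modulus K ! * M makes the division by the coefficient suc a ≤ K exact and keeps the quotient fixed modulo M.
transfer : ∀ {K M} → 1 ≤ K → {ρ σ : Vec ℕ n} {x : ℕ} → Near K (K * M + K) x ρ →
  Sim (K * K + K * (K * M + K)) (K ! * M) ρ σ → ∃ λ y → Sim K M (x ∷ ρ) (y ∷ σ)
transfer {K = K} {M} 1≤K {ρ} {σ} {x} (a , e , c , a≤ , e≤ , c≤ , eq) (sim ρ≲σ σ≲ρ ρ≡σ)
  with Div.divides t K!≡ ← factor a≤ | q , cσ ← ρ≡σ c = y , sim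
    (≲-extend ρ σ x y a e c a≤ e≤ c≤ K≤E ρ≲σ eq eq-y)
    (≲-extend σ ρ y x a e c a≤ e≤ c≤ K≤E σ≲ρ eq-y eq)
    (mod-extend (mod-∣ (Div.n∣m*n (K !)) ρ≡σ))
  where
  E = K * M + K
  K≤E : K ≤ E
  K≤E = ℕₚ.m≤n+m K (K * M)
  instance _ = ℕ.>-nonZero 1≤K
  z : ℤ
  -- From ρ to σ the form c grows by `K ! * M * q`, where K ! = t * (a + 1); dividing by a + 1
  -- leaves the increment M * (t * q).
  z = + x ℤ.+ + M ℤ.* (+ t ℤ.* q)
  lemma : ∀ a x M t q → a ℤ.* (x ℤ.+ M ℤ.* (t ℤ.* q)) ≡ a ℤ.* x ℤ.+ t ℤ.* a ℤ.* M ℤ.* q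
  lemma = solve-∀
  eq-z : + suc a ℤ.* z ≡ e ℤ.+ dot c σ
  eq-z = begin
    + suc a ℤ.* z                                          ≡⟨ lemma (+ suc a) (+ x) (+ M) (+ t) q ⟩
    + suc a ℤ.* + x ℤ.+ + t ℤ.* + suc a ℤ.* + M ℤ.* q      ≡⟨ cong (λ w → + suc a ℤ.* + x ℤ.+ w ℤ.* + M ℤ.* q) (ℤₚ.pos-* t (suc a)) ⟨
    + suc a ℤ.* + x ℤ.+ + (t * suc a) ℤ.* + M ℤ.* q        ≡⟨ cong (λ w → + suc a ℤ.* + x ℤ.+ + w ℤ.* + M ℤ.* q) K!≡ ⟨
    + suc a ℤ.* + x ℤ.+ + (K !) ℤ.* + M ℤ.* q              ≡⟨ cong (λ w → + suc a ℤ.* + x ℤ.+ w ℤ.* q) (ℤₚ.pos-* (K !) M) ⟨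
    + suc a ℤ.* + x ℤ.+ + (K ! * M) ℤ.* q                  ≡⟨ cong (ℤ._+ + (K ! * M) ℤ.* q) eq ⟩
    e ℤ.+ dot c ρ ℤ.+ + (K ! * M) ℤ.* q                    ≡⟨ ℤₚ.+-assoc e (dot c ρ) _ ⟩
    e ℤ.+ (dot c ρ ℤ.+ + (K ! * M) ℤ.* q)                  ≡⟨ cong (ℤ._+_ e) cσ ⟨
    e ℤ.+ dot c σ                                          ∎
    where open ≡-Reasoning
  0≤z : 0ℤ ℤ.≤ z
  -- The form e + c·ρ equals (a + 1) * x ≥ 0 and is among the forms on which ρ and σ agree, so the
  -- quotient at σ is a natural number.
  0≤z = ℤₚ.*-cancelˡ-≤-pos 0ℤ z (+ suc a) (subst₂ ℤ._≤_ (sym (ℤₚ.*-zeroʳ (+ suc a))) (sym eq-z)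
    (ρ≲σ e c (ℕₚ.≤-trans e≤ (ℕₚ.≤-trans (ℕₚ.m≤n*m E K) (ℕₚ.m≤n+m (K * E) (K * K))))
             (bounded-mono (ℕₚ.≤-trans (ℕₚ.m≤m*n K K) (ℕₚ.m≤m+n (K * K) (K * E))) c≤)
             (subst (0ℤ ℤ.≤_) (trans (ℤₚ.pos-* (suc a) x) eq) (ℤ.+≤+ z≤n))))
  y : ℕ
  y = ∣ z ∣
  +y≡z : + y ≡ z
  +y≡z = ℤₚ.0≤i⇒+∣i∣≡i 0≤z
  eq-y : + suc a ℤ.* + y ≡ e ℤ.+ dot c σ
  eq-y = trans (cong (ℤ._*_ (+ suc a)) +y≡z) eq-z
  mod-extend : ρ ≡ σ mod M → (x ∷ ρ) ≡ (y ∷ σ) mod M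
  mod-extend ρ≡σ (b ∷ bs) with r , bσ ← ρ≡σ bs = b ℤ.* (+ t ℤ.* q) ℤ.+ r ,
    trans (cong₂ (λ u v → b ℤ.* u ℤ.+ v) +y≡z bσ) (identity b (+ x) (+ M) (+ t ℤ.* q) (dot bs ρ) r)
    where
    identity : ∀ b x M s u r → b ℤ.* (x ℤ.+ M ℤ.* s) ℤ.+ (u ℤ.+ M ℤ.* r) ≡ b ℤ.* x ℤ.+ u ℤ.+ M ℤ.* (b ℤ.* s ℤ.+ r)
    identity = solve-∀

-- The multiple (a + 1) * x already dominates x. This makes the search for an existential witness
-- finite.
near-bound : ∀ {K E x} {ρ : Vec ℕ n} → Near K E x ρ → x ≤ E + K * sum ρ
near-bound {x = x} {ρ} (a , e , c , _ , e≤ , c≤ , eq) = ℕₚ.≤-trans (ℕₚ.m≤n*m x (suc a))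
  (subst (_≤ _) (trans (cong ∣_∣ (sym eq)) (ℤₚ.∣i*j∣≡∣i∣*∣j∣ (+ suc a) (+ x))) (∣+∣-bound e (dot c ρ) e≤ (∣dot∣-bound ρ c≤)))

-- Presburger predicates

-- A semantic stand-in for quantifier-free definability. The decision procedure is carried along
-- because the bounded search in `Tame-∃` runs the one for the matrix.
record Tame {n} (P : Vec ℕ n → Set) : Set where
  field
    P?  : ∀ ρ → Dec (P ρ)
    K M : ℕ
    .{{M≢0}} : NonZero M
    invariant : ∀ {ρ σ} → Sim K M ρ σ → P ρ → P σ
open Tame

private variable
  P Q S : Vec ℕ n → Set

abstract
  -- The sum of the bounds and the product of the moduli refine both given equivalences. As `Sim` is
  -- symmetric, `inv` receives implications both ways, which contravariant connectives need.
  combine : Tame P → Tame Q → (∀ ρ → Dec (P ρ) → Dec (Q ρ) → Dec (S ρ)) →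
    (∀ {ρ σ} → (P ρ → P σ) → (P σ → P ρ) → (Q ρ → Q σ) → (Q σ → Q ρ) → S ρ → S σ) → Tame S
  combine p q dec inv = record
    { P? = λ ρ → dec ρ (P? p ρ) (P? q ρ)
    ; K = K p + K q
    ; M = M p * M q
    ; M≢0 = ℕₚ.m*n≢0 (M p) (M q)
    ; invariant = λ s →
        let sp = Sim-mono (ℕₚ.m≤m+n (K p) (K q)) (Div.m∣m*n (M q)) s
            sq = Sim-mono (ℕₚ.m≤n+m (K q) (K p)) (Div.n∣m*n (M p)) s
        in inv (invariant p sp) (invariant p (Sim-sym sp)) (invariant q sq) (invariant q (Sim-sym sq))
    }

Tame-× : Tame P → Tame Q → Tame (λ ρ → P ρ × Q ρ)
Tame-× p q = combine p q (λ _ → _×-dec_) λ f _ g _ (x , y) → f x , g y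

Tame-⊎ : Tame P → Tame Q → Tame (λ ρ → P ρ ⊎ Q ρ)
Tame-⊎ p q = combine p q (λ _ → _⊎-dec_) λ f _ g _ → Sum.map f g

Tame-→ : Tame P → Tame Q → Tame (λ ρ → P ρ → Q ρ)
Tame-→ p q = combine p q (λ _ → _→-dec_) λ _ f g _ h → g ∘ h ∘ f

Tame-¬ : Tame P → Tame (λ ρ → ¬ P ρ)
Tame-¬ p = combine p p (λ _ d _ → ¬? d) λ _ f _ _ ¬x → ¬x ∘ f

Tame-⇔ : (∀ {ρ} → P ρ → Q ρ) → (∀ {ρ} → Q ρ → P ρ) → Tame P → Tame Q
Tame-⇔ f g p = combine p p (λ _ d _ → map′ f g d) λ h _ _ _ → f ∘ h ∘ g

abstract
  -- A witness over ρ is moved by `descend` to a candidate, which `transfer` carries over to σ.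
  -- Candidates are bounded by `near-bound`, so trying all numbers up to that bound decides the
  -- quantifier.
  Tame-∃ : {P : ℕ → Vec ℕ n → Set} → Tame (λ ρ → P (head ρ) (tail ρ)) → Tame (λ ρ → ∃ λ x → P x ρ)
  Tame-∃ {n} {P} p = record
    { P? = P∃?
    ; K = L * L + L * (L * M p + L)
    ; M = L ! * M p
    ; M≢0 = ℕₚ.m*n≢0 (L !) (M p) {{L ℕₚ.!≢0}}
    ; invariant = λ {ρ} {σ} s (x , px) →
        let y , ny , x∼y = descend {K = L} (s≤s z≤n) ρ x
            z , y∼z = transfer {K = L} (s≤s z≤n) ny s
        in z , invariant p (weaken y∼z) (invariant p (weaken x∼y) px)
    }
    where
    L : ℕ
    -- The successor secures 1 ≤ L, required by `descend` and `transfer`.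
    L = suc (K p)
    weaken : ∀ {ρ σ : Vec ℕ (suc n)} → Sim L (M p) ρ σ → Sim (K p) (M p) ρ σ
    weaken = Sim-mono (ℕₚ.n≤1+n (K p)) Div.∣-refl
    bound : Vec ℕ n → ℕ
    bound ρ = (L * M p + L) + L * sum ρ
    P∃? : ∀ ρ → Dec (∃ λ x → P x ρ)
    P∃? ρ = map′ satisfied
      (λ (x , px) → let y , ny , x∼y = descend {K = L} (s≤s z≤n) ρ x in
        lose (∈ₚ.∈-upTo⁺ (s≤s (near-bound ny))) (invariant p (weaken x∼y) px))
      (Any.any? (λ x → P? p (x ∷ ρ)) (upTo (suc (bound ρ))))

Tame-∀ : {P : ℕ → Vec ℕ n → Set} → Tame (λ ρ → P (head ρ) (tail ρ)) → Tame (λ ρ → ∀ x → P x ρ)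
Tame-∀ {n} {P} p = Tame-⇔ (λ {ρ} ¬∃¬ x → decidable-stable (P? p (x ∷ ρ)) (λ ¬px → ¬∃¬ (x , ¬px))) (λ all (x , ¬px) → ¬px (all x))
  (Tame-¬ (Tame-∃ (Tame-¬ p)))

-- Eventual periodicity in one variable

far : ∀ u b {x y} → ∣ u ∣ < x → ∣ u ∣ < y → 0ℤ ℤ.≤ u ℤ.+ b ℤ.* + x → 0ℤ ℤ.≤ u ℤ.+ b ℤ.* + y
far u          (+ zero)  {x} {y} _   _   0≤ = 0≤
far (+ k)      (+ suc a) {x} {y} _   _   0≤ = subst (λ z → 0ℤ ℤ.≤ + k ℤ.+ z) (ℤₚ.pos-* (suc a) y) (ℤ.+≤+ z≤n)
far -[1+ k ]   (+ suc a) {x} {y} _   k<y 0≤ = subst (λ z → 0ℤ ℤ.≤ -[1+ k ] ℤ.+ z) (ℤₚ.pos-* (suc a) y)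
  (subst (0ℤ ℤ.≤_) (sym (ℤₚ.⊖-≥ (ℕₚ.≤-trans (ℕₚ.<⇒≤ k<y) (ℕₚ.m≤n*m y (suc a))))) (ℤ.+≤+ z≤n))
-- A negative multiple of x outweighs u, so the value could not have been nonnegative.
far u          -[1+ a ]  {x} {y} u<x _   0≤ = contradiction (ℕₚ.≤-trans (ℕₚ.m≤n*m x (suc a)) (ax≤∣u∣ u ax≤u)) (ℕₚ.<⇒≱ u<x)
  where
  ax≤u : + (suc a * x) ℤ.≤ u
  ax≤u = ℤₚ.0≤i-j⇒j≤i (subst (λ z → 0ℤ ℤ.≤ u ℤ.+ z)
    (trans (sym (ℤₚ.neg-distribˡ-* (+ suc a) (+ x))) (cong ℤ.-_ (sym (ℤₚ.pos-* (suc a) x)))) 0≤)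
  ax≤∣u∣ : ∀ {N} u → + N ℤ.≤ u → N ≤ ∣ u ∣
  ax≤∣u∣ (+ _) (ℤ.+≤+ p) = p

-- A form in x and ρ is u + b * x with ∣ u ∣ ≤ K * (1 + sum ρ). Beyond that size `far` freezes all
-- signs, and adding M keeps the residues. The threshold is linear in sum ρ and the period does not
-- depend on ρ; the later norm bounds rest on this uniformity.
periodic : {P : Vec ℕ (suc n) → Set} → Tame P → ∃ λ B → ∃ λ M → 1 ≤ M ×
  (∀ ρ x → B * suc (sum ρ) ≤ x → P (x ∷ ρ) ⇔ P (x + M ∷ ρ))
periodic p = suc (K p) , M p , ℕ.>-nonZero⁻¹ (M p) , λ ρ x B≤x →
  let s = ∼-shift ρ x B≤x in mk⇔ (invariant p s) (invariant p (Sim-sym s))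
  where
  ∼-shift : ∀ ρ x → suc (K p) * suc (sum ρ) ≤ x → Sim (K p) (M p) (x ∷ ρ) (x + M p ∷ ρ)
  ∼-shift ρ x B≤x = sim (same-sign B≤x (ℕₚ.m≤n⇒m≤n+o (M p) B≤x)) (same-sign (ℕₚ.m≤n⇒m≤n+o (M p) B≤x) B≤x)
    (mod-shift {M = M p} x (x + M p) {ℤ.1ℤ} ρ (trans (ℤₚ.pos-+ x (M p)) (cong (ℤ._+_ (+ x)) (sym (ℤₚ.*-identityʳ (+ M p))))))
    where
    lemma : ∀ c b u → c ℤ.+ (b ℤ.+ u) ≡ c ℤ.+ u ℤ.+ b
    lemma = solve-∀
    same-sign : ∀ {y z} → suc (K p) * suc (sum ρ) ≤ y → suc (K p) * suc (sum ρ) ≤ z → K p ⊢ y ∷ ρ ≲ (z ∷ ρ)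
    same-sign {y} {z} ≤y ≤z c₀ (b ∷ c) p₀ (_ ∷ q) 0≤ = subst (0ℤ ℤ.≤_) (sym (lemma c₀ (b ℤ.* + z) (dot c ρ)))
      (far u b (ℕₚ.<-≤-trans u< ≤y) (ℕₚ.<-≤-trans u< ≤z) (subst (0ℤ ℤ.≤_) (lemma c₀ (b ℤ.* + y) (dot c ρ)) 0≤))
      where
      u = c₀ ℤ.+ dot c ρ
      u< : ∣ u ∣ < suc (K p) * suc (sum ρ)
      u< = s≤s (ℕₚ.≤-trans (∣+∣-bound c₀ (dot c ρ) p₀ (∣dot∣-bound ρ q))
             (subst (_≤ sum ρ + K p * suc (sum ρ)) (ℕₚ.*-suc (K p) (sum ρ)) (ℕₚ.m≤n+m _ (sum ρ))))

-- Linear substitutions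

record Linear (f : Vec ℕ n → Vec ℕ k) : Set where
  constructor linear
  field
    rows  : Vec (Vec ℤ n) k
    value : ∀ ρ → Vec.map +_ (f ρ) ≡ Vec.map (λ l → dot l ρ) rows

record LinearForm (l : Vec ℕ n → ℕ) : Set where
  constructor linearForm
  field
    row   : Vec ℤ n
    value : ∀ ρ → + l ρ ≡ dot row ρ

linear-id : Linear {n} (λ ρ → ρ)
linear-id {zero}  = linear [] λ { [] → refl }
linear-id {suc n} with linear ls eq ← linear-id {n} = linear ((ℤ.1ℤ ∷ zeros) ∷ Vec.map (0ℤ ∷_) ls) λ { (x ∷ ρ) → cong₂ _∷_
  (sym (trans (cong (ℤ._+_ (ℤ.1ℤ ℤ.* + x)) (dot-zeros ρ)) (trans (ℤₚ.+-identityʳ _) (ℤₚ.*-identityˡ (+ x)))))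
  (trans (eq ρ) (trans (Vecₚ.map-cong (λ l → sym (ℤₚ.+-identityˡ (dot l ρ))) ls) (Vecₚ.map-∘ _ (0ℤ ∷_) ls))) }

linear-take : ∀ m {f : Vec ℕ n → Vec ℕ (m + k)} → Linear f → Linear (take m ∘ f)
linear-take m {f} (linear ls eq) = linear (take m ls) λ ρ →
  trans (sym (Vecₚ.take-map +_ m (f ρ))) (trans (cong (take m) (eq ρ)) (Vecₚ.take-map _ m ls))

linear-drop : ∀ m {f : Vec ℕ n → Vec ℕ (m + k)} → Linear f → Linear (drop m ∘ f)
linear-drop m {f} (linear ls eq) = linear (drop m ls) λ ρ →
  trans (sym (Vecₚ.drop-map +_ m (f ρ))) (trans (cong (drop m) (eq ρ)) (Vecₚ.drop-map _ m ls))

linear-tail : {f : Vec ℕ n → Vec ℕ (suc k)} → Linear f → Linear (tail ∘ f)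
linear-tail {f = f} (linear (l ∷ ls) eq) = linear ls λ ρ → trans (map-tail (f ρ)) (cong tail (eq ρ))
  where
  map-tail : (v : Vec ℕ (suc k)) → Vec.map +_ (tail v) ≡ tail (Vec.map +_ v)
  map-tail (_ ∷ _) = refl

linear-++ : {f : Vec ℕ n → Vec ℕ m} {g : Vec ℕ n → Vec ℕ k} → Linear f → Linear g → Linear (λ ρ → f ρ ++ g ρ)
linear-++ {f = f} {g} (linear ls eq) (linear ls′ eq′) = linear (ls ++ ls′) λ ρ →
  trans (Vecₚ.map-++ +_ (f ρ) (g ρ)) (trans (cong₂ _++_ (eq ρ) (eq′ ρ)) (sym (Vecₚ.map-++ _ ls ls′)))

linear-lookup : {f : Vec ℕ n → Vec ℕ k} → Linear f → ∀ i → LinearForm (λ ρ → lookup (f ρ) i)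
linear-lookup {f = f} (linear ls eq) i = linearForm (lookup ls i) λ ρ →
  trans (sym (Vecₚ.lookup-map i +_ (f ρ))) (trans (cong (λ v → lookup v i) (eq ρ)) (Vecₚ.lookup-map i _ ls))

linear-head : {f : Vec ℕ n → Vec ℕ (suc k)} → Linear f → LinearForm (head ∘ f)
linear-head {k = k} {f = f} f-linear with linearForm a eq ← linear-lookup f-linear zero =
  linearForm a λ ρ → trans (cong +_ (head-lookup (f ρ))) (eq ρ)
  where
  head-lookup : (v : Vec ℕ (suc k)) → head v ≡ lookup v zero
  head-lookup (_ ∷ _) = refl

linear-+ : {l l′ : Vec ℕ n → ℕ} → LinearForm l → LinearForm l′ → LinearForm (λ ρ → l ρ + l′ ρ)
linear-+ {l = l} {l′} (linearForm a eq) (linearForm a′ eq′) = linearForm (a ⊞ a′) λ ρ →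
  trans (ℤₚ.pos-+ (l ρ) (l′ ρ)) (trans (cong₂ ℤ._+_ (eq ρ) (eq′ ρ)) (sym (dot-⊞ a a′ ρ)))

linear-sum : {f : Vec ℕ n → Vec ℕ k} → Linear f → LinearForm (sum ∘ f)
linear-sum {k = zero}  {f} f-linear = linearForm zeros λ ρ → trans (cong +_ (sum-[] (f ρ))) (sym (dot-zeros ρ))
  where
  sum-[] : (v : Vec ℕ 0) → sum v ≡ 0
  sum-[] [] = refl
linear-sum {k = suc k} {f} f-linear with linearForm a eq ← linear-+ (linear-head f-linear) (linear-sum (linear-tail f-linear)) =
  linearForm a λ ρ → trans (cong +_ (sum-∷ (f ρ))) (eq ρ)
  where
  sum-∷ : (v : Vec ℕ (suc k)) → sum v ≡ head v + sum (tail v)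
  sum-∷ (_ ∷ _) = refl

-- The pulled-back form combines the rows with weights at most K, so a single K′ serves all c. The
-- maps are homogeneous, so constant terms of forms stay as they are.
dot-linear : (ls : Vec (Vec ℤ n) k) → ∀ K → ∃ λ K′ → ∀ c → Bounded K c → ∃ λ c′ → Bounded K′ c′ ×
  (∀ ρ v → Vec.map +_ v ≡ Vec.map (λ l → dot l ρ) ls → dot c v ≡ dot c′ ρ)
dot-linear [] K = 0 , λ { [] [] → zeros , bounded-zeros , λ { ρ [] _ → sym (dot-zeros ρ) } }
dot-linear (l ∷ ls) K with B , lB ← coefficientBound l | K′ , pull ← dot-linear ls K = K * B + K′ , λ
  { (c ∷ cs) (p ∷ ps) → let c′ , p′ , eq = pull cs ps in
    c · l ⊞ c′ , bounded-⊞ (bounded-· {s = c} p lB) p′ , λ { ρ (x ∷ v) e →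
      trans (cong₂ (λ y z → c ℤ.* y ℤ.+ z) (Vecₚ.∷-injectiveˡ e) (eq ρ v (Vecₚ.∷-injectiveʳ e)))
            (sym (trans (dot-⊞ (c · l) c′ ρ) (cong (ℤ._+ dot c′ ρ) (dot-· c l ρ)))) } }

abstract
  Tame-∘ : {f : Vec ℕ n → Vec ℕ k} → Linear f → Tame P → Tame (P ∘ f)
  Tame-∘ {f = f} (linear ls eq) p with K′ , pull ← dot-linear ls (K p) = record
    -- `K p` accommodates the unchanged constant terms, K′ the pulled-back coefficients.
    { P? = P? p ∘ f ; K = K p + K′ ; M = M p
    ; invariant = λ { (sim ≲ ≳ ≡-mod) → invariant p (sim (pull-≲ ≲) (pull-≲ ≳) (pull-mod ≡-mod)) } }
    where
    pull-≲ : ∀ {ρ σ} → (K p + K′) ⊢ ρ ≲ σ → K p ⊢ f ρ ≲ f σ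
    pull-≲ {ρ} {σ} ρ≲σ c₀ c p₀ q 0≤ with c′ , q′ , pulled ← pull c q =
      subst (λ z → 0ℤ ℤ.≤ c₀ ℤ.+ z) (sym (pulled σ (f σ) (eq σ))) (ρ≲σ c₀ c′ (ℕₚ.m≤n⇒m≤n+o K′ p₀) (bounded-mono (ℕₚ.m≤n+m K′ (K p)) q′)
        (subst (λ z → 0ℤ ℤ.≤ c₀ ℤ.+ z) (pulled ρ (f ρ) (eq ρ)) 0≤))
    pull-mod : ∀ {ρ σ} → ρ ≡ σ mod M p → f ρ ≡ f σ mod M p
    pull-mod {ρ} {σ} ρ≡σ c with B , b ← coefficientBound c with c′ , _ , pulled ← proj₂ (dot-linear ls B) c b with q , e ← ρ≡σ c′ =
      q , trans (pulled σ (f σ) (eq σ)) (trans e (cong (ℤ._+ + M p ℤ.* q) (sym (pulled ρ (f ρ) (eq ρ)))))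

abstract
  Tame-≤ : {l l′ : Vec ℕ n → ℕ} → LinearForm l → LinearForm l′ → Tame (λ ρ → l ρ ≤ l′ ρ)
  Tame-≤ {n} {l} {l′} (linearForm a eq) (linearForm a′ eq′) with B , b ← coefficientBound (a′ ⊞ (ℤ.- ℤ.1ℤ) · a) = record
    { P? = λ ρ → l ρ ℕ.≤? l′ ρ ; K = B ; M = 1
    ; invariant = λ {ρ} {σ} s → ℤₚ.drop‿+≤+ ∘ ℤₚ.0≤i-j⇒j≤i ∘ subst (0ℤ ℤ.≤_) (difference σ)
        ∘ Sim.≲ s 0ℤ _ z≤n b ∘ subst (0ℤ ℤ.≤_) (sym (difference ρ)) ∘ ℤₚ.i≤j⇒0≤j-i ∘ ℤ.+≤+ }
    where
    lemma : ∀ u v → 0ℤ ℤ.+ (v ℤ.+ ℤ.- ℤ.1ℤ ℤ.* u) ≡ v ℤ.- u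
    lemma = solve-∀
    difference : ∀ ρ → 0ℤ ℤ.+ dot (a′ ⊞ (ℤ.- ℤ.1ℤ) · a) ρ ≡ + l′ ρ ℤ.- + l ρ
    difference ρ = begin
      0ℤ ℤ.+ dot (a′ ⊞ (ℤ.- ℤ.1ℤ) · a) ρ                ≡⟨ cong (ℤ._+_ 0ℤ) (trans (dot-⊞ a′ _ ρ) (cong (ℤ._+_ (dot a′ ρ)) (dot-· (ℤ.- ℤ.1ℤ) a ρ))) ⟩
      0ℤ ℤ.+ (dot a′ ρ ℤ.+ ℤ.- ℤ.1ℤ ℤ.* dot a ρ)        ≡⟨ lemma (dot a ρ) (dot a′ ρ) ⟩
      dot a′ ρ ℤ.- dot a ρ                              ≡⟨ cong₂ ℤ._-_ (eq′ ρ) (eq ρ) ⟨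
      + l′ ρ ℤ.- + l ρ                                  ∎
      where open ≡-Reasoning

Tame-< : {l l′ : Vec ℕ n → ℕ} → LinearForm l → LinearForm l′ → Tame (λ ρ → l ρ < l′ ρ)
Tame-< a a′ = Tame-⇔ ℕₚ.≰⇒> ℕₚ.<⇒≱ (Tame-¬ (Tame-≤ a′ a))

Tame-≡ : {l l′ : Vec ℕ n → ℕ} → LinearForm l → LinearForm l′ → Tame (λ ρ → l ρ ≡ l′ ρ)
Tame-≡ a a′ = Tame-⇔ (λ (p , q) → ℕₚ.≤-antisym p q) (λ e → ℕₚ.≤-reflexive e , ℕₚ.≤-reflexive (sym e))
  (Tame-× (Tame-≤ a a′) (Tame-≤ a′ a))

Tame-∷ : {P : Vec ℕ (suc n) → Set} → Tame P → Tame (λ ρ → P (head ρ ∷ tail ρ))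
Tame-∷ {P = P} = Tame-⇔ (λ { {_ ∷ _} p → p }) (λ { {_ ∷ _} p → p })

-- Definable relations between tuples

⟦⟧-linear : (t : Term n) → LinearForm ⟦ t ⟧
⟦⟧-linear (var i) = linear-lookup linear-id i
⟦⟧-linear (s ⊕ t) = linear-+ (⟦⟧-linear s) (⟦⟧-linear t)

Tame-Sat : (φ : Formula n) → Tame (Sat φ)
Tame-Sat (s ≐ t)  = Tame-≡ (⟦⟧-linear s) (⟦⟧-linear t)
Tame-Sat (¬' φ)   = Tame-¬ (Tame-Sat φ)
Tame-Sat (φ ∧' ψ) = Tame-× (Tame-Sat φ) (Tame-Sat ψ)
Tame-Sat (φ ∨' ψ) = Tame-⊎ (Tame-Sat φ) (Tame-Sat ψ)
Tame-Sat (φ ⇒' ψ) = Tame-→ (Tame-Sat φ) (Tame-Sat ψ)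
Tame-Sat (∀' φ)   = Tame-∀ (Tame-∷ (Tame-Sat φ))
Tame-Sat (∃' φ)   = Tame-∃ (Tame-∷ (Tame-Sat φ))

Tame-∃* : ∀ m {P : Vec ℕ m → Vec ℕ n → Set} → Tame (λ ρ → P (take m ρ) (drop m ρ)) → Tame (λ ρ → ∃ λ v → P v ρ)
Tame-∃* zero    p = Tame-⇔ (λ q → [] , q) (λ { ([] , q) → q }) p
Tame-∃* (suc m) p = Tame-⇔ (λ (v , x , q) → x ∷ v , q) (λ { (x ∷ v , q) → v , x , q })
  (Tame-∃* m (Tame-∃ (Tame-⇔ (λ { {_ ∷ _} q → q }) (λ { {_ ∷ _} q → q }) p)))

Tame-∀* : ∀ m {P : Vec ℕ m → Vec ℕ n → Set} → Tame (λ ρ → P (take m ρ) (drop m ρ)) → Tame (λ ρ → ∀ v → P v ρ)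
Tame-∀* zero    p = Tame-⇔ (λ { q [] → q }) (λ q → q []) p
Tame-∀* (suc m) p = Tame-⇔ (λ { q (x ∷ v) → q v x }) (λ q v x → q (x ∷ v))
  (Tame-∀* m (Tame-∀ (Tame-⇔ (λ { {_ ∷ _} q → q }) (λ { {_ ∷ _} q → q }) p)))

take-drop-++ : ∀ m (v : Vec ℕ m) (w : Vec ℕ n) → take m (v ++ w) ≡ v × drop m (v ++ w) ≡ w
take-drop-++ m v w = Vecₚ.++-injective (take m (v ++ w)) v (Vecₚ.take++drop≡id m (v ++ w))

-- Closure under linear substitution is built in, so that a relation can be used under further
-- quantifiers whatever the layout of the variables there.
Tame₂ : (Vec ℕ m → Vec ℕ n → Set) → Set
Tame₂ {m} {n} P = ∀ {k} {f : Vec ℕ k → Vec ℕ m} {g : Vec ℕ k → Vec ℕ n} →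
  Linear f → Linear g → Tame (λ ρ → P (f ρ) (g ρ))

tame₂ : ∀ {m} (P : Vec ℕ m → Vec ℕ n → Set) → Tame (λ ρ → P (take m ρ) (drop m ρ)) → Tame₂ P
tame₂ {m = m} P t {f = f} {g} f-linear g-linear = Tame-⇔
  (λ {ρ} → let e , e′ = take-drop-++ m (f ρ) (g ρ) in subst₂ P e e′)
  (λ {ρ} → let e , e′ = take-drop-++ m (f ρ) (g ρ) in subst₂ P (sym e) (sym e′))
  (Tame-∘ (linear-++ f-linear g-linear) t)

first : ∀ m → Linear {m + n} (take m)
first m = linear-take m linear-id

rest : ∀ m → Linear {m + n} (drop m)
rest m = linear-drop m linear-id

dec₂ : ∀ {m} (P : Vec ℕ m → Vec ℕ n → Set) → Tame₂ P → ∀ v w → Dec (P v w)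
dec₂ {m = m} P t v w = let e , e′ = take-drop-++ m v w in
  subst₂ (λ v w → Dec (P v w)) e e′ (P? (t (first m) (rest m)) (v ++ w))

-- Finite covers and least representatives

FinitelyCovered : (Vec ℕ m → Set) → (Vec ℕ m → Vec ℕ m → Set) → Set
FinitelyCovered Q W = ∃ λ N → ∀ c → Q c → ∃ λ c′ → Q c′ × sum c′ ≤ N × W c c′

module _ {m n} {Q : Vec ℕ m → Vec ℕ n → Set} {W : Vec ℕ m → Vec ℕ m → Set} (Q-tame : Tame₂ Q) (W-tame : Tame₂ W) where

  private
    Covered : Vec ℕ m → Vec ℕ (suc n) → Set
    Covered c ρ = ∃ λ c′ → Q c′ (tail ρ) × sum c′ ≤ head ρ × W c c′

    Covered-tame : Tame₂ Covered
    Covered-tame = tame₂ Covered (Tame-∃* m (Tame-× (Q-tame (first m) (linear-tail (linear-drop m (rest m))))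
      (Tame-× (Tame-≤ (linear-sum (first m)) (linear-head (linear-drop m (rest m)))) (W-tame (linear-take m (rest m)) (first m)))))

  Tame-FinitelyCovered : Tame (λ ρ → FinitelyCovered (λ c → Q c ρ) W)
  Tame-FinitelyCovered = Tame-∃ (Tame-⇔ (λ { {_ ∷ _} p → p }) (λ { {_ ∷ _} p → p })
    (Tame-∀* m {λ c ρ → Q c (tail ρ) → Covered c ρ} (Tame-→ (Q-tame (first m) (linear-tail (rest m))) (Covered-tame (first m) (rest m)))))

  private
    Smaller : Vec ℕ m → Vec ℕ n → Set
    Smaller c ρ = ∃ λ c′ → Q c′ ρ × sum c′ < sum c × W c c′

    Smaller-tame : Tame₂ Smaller
    Smaller-tame = tame₂ Smaller (Tame-∃* m (Tame-× (Q-tame (first m) (linear-drop m (rest m)))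
      (Tame-× (Tame-< (linear-sum (first m)) (linear-sum (linear-take m (rest m)))) (W-tame (linear-take m (rest m)) (first m)))))

    -- Passing from classes to the norms of their least members leaves a predicate of one number and
    -- ρ, to which `periodic` applies. A tuple that witnesses x is W-related to no member of Q of
    -- norm below x.
    FreshNorm : ℕ → Vec ℕ n → Set
    FreshNorm x ρ = ∃ λ c → Q c ρ × sum c ≡ x × ¬ Smaller c ρ

    FreshNorm-tame : Tame (λ ρ → FreshNorm (head ρ) (tail ρ))
    FreshNorm-tame = Tame-∃* m (Tame-× (Q-tame (first m) (linear-tail (rest m)))
      (Tame-× (Tame-≡ (linear-sum (first m)) (linear-head (rest m))) (Tame-¬ (Smaller-tame (first m) (linear-tail (rest m))))))

    Uncovered-tame : Tame (λ ρ → ∃ λ c → Q c (tail ρ) × ¬ Covered c ρ)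
    Uncovered-tame = Tame-∃* m (Tame-× (Q-tame (first m) (linear-tail (rest m))) (Tame-¬ (Covered-tame (first m) (rest m))))

  module _ (W-refl : ∀ {ρ c} → Q c ρ → W c c)
           (W-trans : ∀ {ρ a b c} → Q a ρ → Q b ρ → Q c ρ → W a b → W b c → W a c) where

    private
      smallest : ∀ ρ c → Q c ρ → ∃ λ c′ → Q c′ ρ × W c c′ × ¬ Smaller c′ ρ
      smallest ρ c q = go c q (<-wellFounded (sum c))
        where
        go : ∀ c → Q c ρ → Acc _<_ (sum c) → ∃ λ c′ → Q c′ ρ × W c c′ × ¬ Smaller c′ ρ
        go c q (acc rec) with dec₂ Smaller Smaller-tame c ρ
        ... | no ¬s = c , q , W-refl q , ¬s
        ... | yes (d , qd , d<c , cWd) with e , qe , dWe , ¬s ← go d qd (rec d<c) = e , qe , W-trans q qd qe cWd dWe , ¬s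

      -- Some c in Q is not covered within norm N. Its least representative must then have norm
      -- above N, for otherwise it would cover c.
      fresh-beyond : ∀ ρ → ¬ FinitelyCovered (λ c → Q c ρ) W → ∀ N → ∃ λ x → N < x × FreshNorm x ρ
      fresh-beyond ρ ¬fin N with P? Uncovered-tame (N ∷ ρ)
      ... | no ¬unc = contradiction (N , λ c q → decidable-stable (dec₂ Covered Covered-tame c (N ∷ ρ)) (λ ¬cov → ¬unc (c , q , ¬cov))) ¬fin
      ... | yes (c , q , ¬cov) with c′ , q′ , cWc′ , ¬s ← smallest ρ c q =
        sum c′ , ℕₚ.≰⇒> (λ ≤N → ¬cov (c′ , q′ , ≤N , cWc′)) , c′ , q′ , refl , ¬s

    private
      module _ (B M : ℕ) (1≤M : 1 ≤ M)
        (shift : ∀ ρ x → B * suc (sum ρ) ≤ x → FreshNorm x ρ ⇔ FreshNorm (x + M) ρ) where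

        up : ∀ ρ x → B * suc (sum ρ) ≤ x → FreshNorm x ρ → FreshNorm (x + M) ρ
        up ρ x b≤x = Equivalence.to (shift ρ x b≤x)

        -- Nothing bounds the norm found by `fresh-beyond`; going back by steps of M brings it into
        -- the first period after the threshold, where it is linear in sum ρ.
        down : ∀ ρ x → Acc _<_ x → B * suc (sum ρ) ≤ x → FreshNorm x ρ →
          ∃ λ y → B * suc (sum ρ) ≤ y × y < B * suc (sum ρ) + M × FreshNorm y ρ
        down ρ x (acc rec) b≤x fx with x ℕ.<? B * suc (sum ρ) + M
        ... | yes x< = x , b≤x , x< , fx
        ... | no x≮ with z , refl ← ≤⇒+ (ℕₚ.m+n≤o⇒n≤o (B * suc (sum ρ)) (ℕₚ.≮⇒≥ x≮)) =
          let b≤z = ℕₚ.+-cancelʳ-≤ M _ z (ℕₚ.≮⇒≥ x≮)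
          in down ρ z (rec (ℕₚ.m<m+n z 1≤M)) b≤z (Equivalence.from (shift ρ z b≤z) fx)

        climb : ∀ ρ y → B * suc (sum ρ) ≤ y → FreshNorm y ρ → ∀ N → FreshNorm (y + N * M) ρ
        climb ρ y b≤y fy zero    = subst (λ x → FreshNorm x ρ) (sym (ℕₚ.+-identityʳ y)) fy
        climb ρ y b≤y fy (suc N) = subst (λ x → FreshNorm x ρ) (ℕₚ.+-assoc y M (N * M))
          (climb ρ (y + M) (ℕₚ.m≤n⇒m≤n+o M b≤y) (up ρ y b≤y fy) N)

        collect : ∀ ρ y → B * suc (sum ρ) ≤ y → FreshNorm y ρ → ∀ N → ∃ λ cs → List.length cs ≡ N ×
          All (λ c → Q c ρ × sum c < y + N * M) cs × AllPairs (λ c c′ → ¬ W c c′) cs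
        collect ρ y b≤y fy zero = [] , refl , [] , []
        collect ρ y b≤y fy (suc N)
          with cs , len , all , pairs ← collect ρ y b≤y fy N | c , q , c≡ , ¬s ← climb ρ y b≤y fy N =
          c ∷ cs , cong suc len ,
          (q , subst (_< y + suc N * M) (sym c≡) grow) ∷ All.map (λ (q , c<) → q , ℕₚ.<-trans c< grow) all ,
          -- The earlier tuples have smaller norm, and the fresh c is related to nothing smaller.
          All.map (λ {c′} (q′ , c′<) cWc′ → ¬s (c′ , q′ , subst (sum c′ <_) (sym c≡) c′< , cWc′)) all ∷ pairs
          where
          grow : y + N * M < y + suc N * M
          grow = ℕₚ.+-monoʳ-< y (ℕₚ.m<n+m (N * M) 1≤M)

        spread : ∀ ρ → ¬ FinitelyCovered (λ c → Q c ρ) W → ∀ N → ∃ λ cs → List.length cs ≡ N ×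
          All (λ c → Q c ρ × sum c ≤ (B + M) * suc (sum ρ) + N * (B + M)) cs × AllPairs (λ c c′ → ¬ W c c′) cs
        spread ρ ¬fin N =
          let b = B * suc (sum ρ)
              x , b<x , fx = fresh-beyond ρ ¬fin b
              y , b≤y , y<b+M , fy = down ρ x (<-wellFounded x) (ℕₚ.<⇒≤ b<x) fx
              cs , len , all , pairs = collect ρ y b≤y fy N
          -- Both y < B * (1 + sum ρ) + M and the N periods of length M are absorbed into the one
          -- constant B + M.
          in cs , len , All.map (λ (q , c<) → q , ℕₚ.<⇒≤ (ℕₚ.<-≤-trans c< (ℕₚ.+-mono-≤
               (ℕₚ.≤-trans (ℕₚ.<⇒≤ y<b+M) (subst (b + M ≤_) (sym (ℕₚ.*-distribʳ-+ (suc (sum ρ)) B M)) (ℕₚ.+-monoʳ-≤ b (ℕₚ.m≤m*n M (suc (sum ρ))))))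
               (ℕₚ.*-monoʳ-≤ N (ℕₚ.m≤n+m M B))))) all , pairs

    -- The norms of the least representatives of the W-classes form a Presburger set, hence an eventually
    -- periodic one, with period and preperiod controlled uniformly in ρ.
    representatives : ∃ λ B → ∀ ρ → ¬ FinitelyCovered (λ c → Q c ρ) W → ∀ N → ∃ λ cs → List.length cs ≡ N ×
      All (λ c → Q c ρ × sum c ≤ B * suc (sum ρ) + N * B) cs × AllPairs (λ c c′ → ¬ W c c′) cs
    representatives = let B , M , 1≤M , shift = periodic FreshNorm-tame in B + M , spread B M 1≤M shift

-- Counting and ranks

length-vectors : ∀ {a} {A : Set a} (xs : List A) n → List.length (vectors xs n) ≡ List.length xs ^ n
length-vectors xs zero    = refl
length-vectors xs (suc n) = trans (length-× xs) (cong (List.length xs *_) (length-vectors xs n))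
  where
  length-× : ∀ ys → List.length (cartesianProductWith Vec._∷_ ys (vectors xs n)) ≡ List.length ys * List.length (vectors xs n)
  length-× []       = refl
  length-× (y ∷ ys) = trans (Listₚ.length-++ (List.map (Vec._∷_ y) (vectors xs n)))
    (cong₂ _+_ (Listₚ.length-map (Vec._∷_ y) (vectors xs n)) (length-× ys))

∈-box : ∀ {N} (v : Vec ℕ n) → sum v ≤ N → v ∈ vectors (upTo (suc N)) n
∈-box v v≤N = ∈-vectors (entries v v≤N)
  where
  entries : ∀ {n N} (v : Vec ℕ n) → sum v ≤ N → VecAll.All (_∈ upTo (suc N)) v
  entries []      _   = []
  entries (x ∷ v) v≤N = ∈ₚ.∈-upTo⁺ (s≤s (ℕₚ.m+n≤o⇒m≤o x v≤N)) ∷ entries v (ℕₚ.m+n≤o⇒n≤o x v≤N)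

sum-++ : (v : Vec ℕ n) (w : Vec ℕ k) → sum (v ++ w) ≡ sum v + sum w
sum-++ []      w = refl
sum-++ (x ∷ v) w = trans (cong (ℕ._+_ x) (sum-++ v w)) (sym (ℕₚ.+-assoc x (sum v) (sum w)))

AllPairs-lookup : ∀ {a r} {A : Set a} {R : Rel A r} {xs} → AllPairs R xs →
  ∀ i j → i Fin.< j → R (List.lookup xs i) (List.lookup xs j)
AllPairs-lookup (p ∷ _)  zero    (suc j) _         = All.lookup p (∈ₚ.∈-lookup j)
AllPairs-lookup (_ ∷ ps) (suc i) (suc j) (s≤s i<j) = AllPairs-lookup ps i j i<j

-- Pigeonhole: sending an index of xs to the position of its image in ys is injective.
length-≤ : ∀ {a b} {A : Set a} {B : Set b} (f : A → B) {xs : List A} {ys : List B} →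
  AllPairs (λ x y → f x ≢ f y) xs → All (λ x → f x ∈ ys) xs → List.length xs ≤ List.length ys
length-≤ f {xs} {ys} distinct xs⊆ys = Finₚ.injective⇒≤ {f = position} injective
  where
  member : ∀ i → f (List.lookup xs i) ∈ ys
  member i = All.lookup xs⊆ys (∈ₚ.∈-lookup i)
  position : Fin (List.length xs) → Fin (List.length ys)
  position i = Any.index (member i)
  injective : ∀ {i j} → position i ≡ position j → i ≡ j
  injective {i} {j} eq = by-order (Finₚ.<-cmp i j)
    where
    same : f (List.lookup xs i) ≡ f (List.lookup xs j)
    same = trans (Anyₚ.lookup-index (member i)) (trans (cong (List.lookup ys) eq) (sym (Anyₚ.lookup-index (member j))))
    by-order : Tri (i Fin.< j) (i ≡ j) (j Fin.< i) → i ≡ j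
    by-order (tri< i<j _ _) = contradiction same (AllPairs-lookup distinct i j i<j)
    by-order (tri≈ _ i≡j _) = i≡j
    by-order (tri> _ _ j<i) = contradiction (sym same) (AllPairs-lookup distinct j i j<i)

^-distribʳ-* : ∀ n i j → (i * j) ^ n ≡ i ^ n * j ^ n
^-distribʳ-* zero    i j = refl
^-distribʳ-* (suc n) i j rewrite ^-distribʳ-* n i j = lemma i j (i ^ n) (j ^ n)
  where
  lemma : ∀ i j u v → i * j * (u * v) ≡ i * u * (j * v)
  lemma = ℕ-Solver.solve-∀

-- The relations ≃ₖ inside an interpretation

module Ranks {ℓ ℓ′} {m : ℕ} {L : Set ℓ} {_≺_ : Rel L ℓ′}
  (isStrictTotalOrder : IsStrictTotalOrder _≡_ _≺_) (interpretation : Interpretation L _≺_ m) where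

  open Interpretation interpretation
  private
    module ≺ = IsStrictTotalOrder isStrictTotalOrder

  Element : Set
  Element = Σ (Vec ℕ m) (Sat D)

  ⟨_⟩ : Element → L
  ⟨ a , d ⟩ = h a d

  norm : Element → ℕ
  norm (a , _) = sum a

  private variable
    x y z : Element

  _∼_ _⋖_ : Vec ℕ m → Vec ℕ m → Set
  a ∼ b = Sat E (a ++ b)
  a ⋖ b = Sat R (a ++ b)

  ∼⇒≡ : proj₁ x ∼ proj₁ y → ⟨ x ⟩ ≡ ⟨ y ⟩
  ∼⇒≡ {a , d} {b , e} = Equivalence.from (h-≡ a b d e)

  ≡⇒∼ : ⟨ x ⟩ ≡ ⟨ y ⟩ → proj₁ x ∼ proj₁ y
  ≡⇒∼ {a , d} {b , e} = Equivalence.to (h-≡ a b d e)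

  ⋖⇒≺ : proj₁ x ⋖ proj₁ y → ⟨ x ⟩ ≺ ⟨ y ⟩
  ⋖⇒≺ {a , d} {b , e} = Equivalence.from (h-≺ a b d e)

  ≺⇒⋖ : ⟨ x ⟩ ≺ ⟨ y ⟩ → proj₁ x ⋖ proj₁ y
  ≺⇒⋖ {a , d} {b , e} = Equivalence.to (h-≺ a b d e)

  Between : Vec ℕ m → Vec ℕ m → Vec ℕ m → Set
  Between a b c = Sat D c × ((a ⋖ c × c ⋖ b) ⊎ (b ⋖ c × c ⋖ a))

  -- Bounded subsets of ℕᵐ are finite, so the relations VDEquiv are Presburger definable: these are their definitions.
  Close : ℕ → Vec ℕ m → Vec ℕ m → Set
  Close zero    a b = a ∼ b
  Close (suc k) a b = FinitelyCovered (Between a b) (Close k)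

  D-tame : {f : Vec ℕ n → Vec ℕ m} → Linear f → Tame (λ ρ → Sat D (f ρ))
  D-tame f-linear = Tame-∘ f-linear (Tame-Sat D)

  ⋖-tame : Tame₂ _⋖_
  ⋖-tame f-linear g-linear = Tame-∘ (linear-++ f-linear g-linear) (Tame-Sat R)

  -- Both ends form one parameter tuple, so that an interval is a family Q c ρ with ρ its pair of
  -- ends.
  BetweenEnds : Vec ℕ m → Vec ℕ (m + m) → Set
  BetweenEnds c ρ = Between (take m ρ) (drop m ρ) c

  Between-tame : Tame₂ BetweenEnds
  Between-tame c-linear ρ-linear = Tame-× (D-tame c-linear)
    (Tame-⊎ (Tame-× (⋖-tame a-linear c-linear) (⋖-tame c-linear b-linear))
            (Tame-× (⋖-tame b-linear c-linear) (⋖-tame c-linear a-linear)))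
    where
    a-linear = linear-take m ρ-linear
    b-linear = linear-drop m ρ-linear

  Close-tame : ∀ k → Tame₂ (Close k)
  Close-tame zero    f-linear g-linear = Tame-∘ (linear-++ f-linear g-linear) (Tame-Sat E)
  Close-tame (suc k) = tame₂ (Close (suc k)) (Tame-FinitelyCovered Between-tame (Close-tame k))

  between⇒ : Between (proj₁ x) (proj₁ y) (proj₁ z) → StrictlyBetween _≺_ ⟨ x ⟩ ⟨ y ⟩ ⟨ z ⟩
  between⇒ {x} {y} {z} = Sum.map (Product.map (⋖⇒≺ {x} {z}) (⋖⇒≺ {z} {y})) (Product.map (⋖⇒≺ {y} {z}) (⋖⇒≺ {z} {x})) ∘ proj₂

  ⇒between : StrictlyBetween _≺_ ⟨ x ⟩ ⟨ y ⟩ ⟨ z ⟩ → Between (proj₁ x) (proj₁ y) (proj₁ z)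
  ⇒between {x} {y} {z} p = proj₂ z ,
    Sum.map (Product.map (≺⇒⋖ {x} {z}) (≺⇒⋖ {z} {y})) (Product.map (≺⇒⋖ {y} {z}) (≺⇒⋖ {z} {x})) p

  Close-reflexive : ∀ k (x y : Element) → ⟨ x ⟩ ≡ ⟨ y ⟩ → Close k (proj₁ x) (proj₁ y)
  Close-reflexive zero    x y x≡y = ≡⇒∼ {x} {y} x≡y
  -- The interval between equal elements is empty, so the bound 0 covers it vacuously.
  Close-reflexive (suc k) x y x≡y = 0 , λ c btw →
    contradiction (subst (λ w → StrictlyBetween _≺_ ⟨ x ⟩ w (h c (proj₁ btw))) (sym x≡y) (between⇒ {x} {y} {c , proj₁ btw} btw)) nothing-between
    where
    nothing-between : ∀ {c} → ¬ StrictlyBetween _≺_ ⟨ x ⟩ ⟨ x ⟩ c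
    nothing-between (inj₁ (p , q)) = ≺.asym p q
    nothing-between (inj₂ (p , q)) = ≺.asym p q

  Close-sym : ∀ k (x y : Element) → Close k (proj₁ x) (proj₁ y) → Close k (proj₁ y) (proj₁ x)
  Close-sym zero    (a , d) (b , e) = E-sym a b d e
  Close-sym (suc k) x y (N , cover) = N , λ c (d , btw) →
    let c′ , (d′ , btw′) , rest = cover c (d , Sum.swap btw) in c′ , (d′ , Sum.swap btw′) , rest

  -- The point c may lie outside the interval; comparing w with c is enough in every case.
  between-split : ∀ {a b} c {w} → StrictlyBetween _≺_ a b w → StrictlyBetween _≺_ a c w ⊎ w ≡ c ⊎ StrictlyBetween _≺_ c b w
  between-split c {w} (inj₁ (a≺w , w≺b)) with ≺.compare w c
  ... | tri< w≺c _ _ = inj₁ (inj₁ (a≺w , w≺c))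
  ... | tri≈ _ w≡c _ = inj₂ (inj₁ w≡c)
  ... | tri> _ _ c≺w = inj₂ (inj₂ (inj₁ (c≺w , w≺b)))
  between-split c {w} (inj₂ (b≺w , w≺a)) with ≺.compare w c
  ... | tri< w≺c _ _ = inj₂ (inj₂ (inj₂ (b≺w , w≺c)))
  ... | tri≈ _ w≡c _ = inj₂ (inj₁ w≡c)
  ... | tri> _ _ c≺w = inj₁ (inj₂ (c≺w , w≺a))

  -- One witness is chosen for each a that has any, and the sum of their norms bounds them all.
  bounded-witnesses : {A : Set} {B : A → Vec ℕ n → Set} → (∀ a → Dec (∃ (B a))) → (as : List A) →
    ∃ λ N → ∀ {a} → a ∈ as → ∃ (B a) → ∃ λ v → B a v × sum v ≤ N
  bounded-witnesses B? [] = 0 , λ ()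
  bounded-witnesses B? (a ∷ as) with bounded-witnesses B? as | B? a
  ... | N , f | no ¬b = N , λ { (here refl) b → contradiction b ¬b ; (there a∈) b → f a∈ b }
  ... | N , f | yes (v , b) = sum v + N , λ
    { (here refl) _ → v , b , ℕₚ.m≤m+n (sum v) N
    ; (there a∈) b → let w , bw , w≤ = f a∈ b in w , bw , ℕₚ.≤-trans w≤ (ℕₚ.m≤n+m N (sum v)) }

  mutual
    -- Representatives from outside Q suffice: each class met by Q is then replaced by a member of Q.
    covered-from-outside : ∀ k {Q : Vec ℕ m → Set} → (∀ c → Q c → Sat D c) →
      (∀ c → Dec (∃ λ c′ → Q c′ × Close k c c′)) → ∀ N →
      (∀ c → Q c → ∃ λ d → Sat D d × sum d ≤ N × Close k c d) → FinitelyCovered Q (Close k)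
    covered-from-outside k Q⊆D Q? N cover with N′ , pick ← bounded-witnesses Q? (vectors (upTo (suc N)) m) =
      N′ , λ c q →
        let d , Dd , d≤N , c~d = cover c q
            c″ = (c , Q⊆D c q)
            c′ , (q′ , d~c′) , c′≤ = pick (∈-box d d≤N) (c , q , Close-sym k c″ (d , Dd) c~d)
        in c′ , q′ , c′≤ , Close-trans k c″ (d , Dd) (c′ , Q⊆D c′ q′) c~d d~c′

    -- The covers of the two intervals, together with y, meet every class of the interval from x to
    -- z. These representatives may lie outside it, whence the call to `covered-from-outside` one
    -- level down.
    Close-trans : ∀ k (x y z : Element) → Close k (proj₁ x) (proj₁ y) → Close k (proj₁ y) (proj₁ z) → Close k (proj₁ x) (proj₁ z)
    Close-trans zero    (a , d) (b , e) (c , f) = E-trans a b c d e f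
    Close-trans (suc k) x y z (M , f) (N , g) = covered-from-outside k (λ _ → proj₁) neighbour? (M + (sum (proj₁ y) + N))
      λ c btw → locate c (proj₁ btw) (between-split ⟨ y ⟩ (between⇒ {x} {z} {c , proj₁ btw} btw))
      where
      Neighbour : Vec ℕ m → Vec ℕ (m + m) → Set
      Neighbour c ρ = ∃ λ c′ → BetweenEnds c′ ρ × Close k c c′
      neighbour? : ∀ c → Dec (∃ λ c′ → Between (proj₁ x) (proj₁ z) c′ × Close k c c′)
      neighbour? c = let e , e′ = take-drop-++ m (proj₁ x) (proj₁ z) in
        subst₂ (λ a b → Dec (∃ λ c′ → Between a b c′ × Close k c c′)) e e′
          (dec₂ Neighbour (tame₂ Neighbour (Tame-∃* m (Tame-× (Between-tame (first m) (linear-drop m (rest m)))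
            (Close-tame k (linear-take m (rest m)) (first m))))) c (proj₁ x ++ proj₁ z))
      locate : ∀ c d → StrictlyBetween _≺_ ⟨ x ⟩ ⟨ y ⟩ (h c d) ⊎ h c d ≡ ⟨ y ⟩ ⊎ StrictlyBetween _≺_ ⟨ y ⟩ ⟨ z ⟩ (h c d) →
        ∃ λ c′ → Sat D c′ × sum c′ ≤ M + (sum (proj₁ y) + N) × Close k c c′
      locate c d (inj₁ btw) = let c′ , btw′ , c′≤ , c~ = f c (⇒between {x} {y} {c , d} btw) in
        c′ , proj₁ btw′ , ℕₚ.m≤n⇒m≤n+o _ c′≤ , c~
      locate c d (inj₂ (inj₁ c≡y)) = proj₁ y , proj₂ y , ℕₚ.m≤n⇒m≤o+n M (ℕₚ.m≤m+n _ N) , Close-reflexive k (c , d) y c≡y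
      locate c d (inj₂ (inj₂ btw)) = let c′ , btw′ , c′≤ , c~ = g c (⇒between {y} {z} {c , d} btw) in
        c′ , proj₁ btw′ , ℕₚ.m≤n⇒m≤o+n M (ℕₚ.m≤n⇒m≤o+n (sum (proj₁ y)) c′≤) , c~

  module _ {p} {P : L → Set p} {Q : Vec ℕ m → Set} (Q? : ∀ c → Dec (Q c)) (Q⊆D : ∀ c → Q c → Sat D c)
           (Q⇔P : ∀ x → Q (proj₁ x) ⇔ P ⟨ x ⟩) where

    gather : ∀ cs → ∃ λ xs → All P xs × (∀ x → proj₁ x ∈ cs → Q (proj₁ x) → ⟨ x ⟩ ∈ xs)
    gather [] = [] , [] , λ _ ()
    gather (c ∷ cs) with gather cs | Q? c
    ... | xs , Pxs , ∈xs | no ¬q = xs , Pxs , λ { x (here refl) q → contradiction q ¬q ; x (there x∈) q → ∈xs x x∈ q }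
    ... | xs , Pxs , ∈xs | yes q = h c d ∷ xs , Equivalence.to (Q⇔P (c , d)) q ∷ Pxs ,
        -- The value of `h` might depend on the proof of membership; reflexivity of E identifies the
        -- two values.
        λ { (_ , d′) (here refl) _ → here (∼⇒≡ {c , d′} {c , d} (E-refl c d)) ; x (there x∈) q → there (∈xs x x∈ q) }
      where
      d = Q⊆D c q

    finite : ∀ {r} {_≈_ : Rel L r} {W : Vec ℕ m → Vec ℕ m → Set} → (∀ x y → W (proj₁ x) (proj₁ y) → ⟨ x ⟩ ≈ ⟨ y ⟩) →
      FinitelyCovered Q W → FiniteMod _≺_ P _≈_
    finite {_≈_ = _≈_} W⇒≈ (N , cover) with xs , Pxs , ∈xs ← gather (vectors (upTo (suc N)) m) = xs , Pxs , covered
      where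
      covered : ∀ l → P l → Any (l ≈_) xs
      covered l Pl with c , d , refl ← h-surj l with c′ , q′ , c′≤N , w ← cover c (Equivalence.from (Q⇔P (c , d)) Pl) =
        Any.map (λ { refl → W⇒≈ (c , d) (c′ , Q⊆D c′ q′) w }) (∈xs (c′ , Q⊆D c′ q′) (∈-box c′ c′≤N) q′)

  between? : ∀ a b c → Dec (Between a b c)
  between? a b c = let e , e′ = take-drop-++ m a b in
    subst₂ (λ a b → Dec (Between a b c)) e e′ (dec₂ BetweenEnds Between-tame c (a ++ b))

  -- This direction turns a finite cover by `Close` into one by `VDEquiv`, that is, into an upper
  -- bound on the rank.
  Close⇒VDEquiv : ∀ k (x y : Element) → Close k (proj₁ x) (proj₁ y) → VDEquiv _≺_ k ⟨ x ⟩ ⟨ y ⟩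
  Close⇒VDEquiv zero    x y x∼y = lift (∼⇒≡ {x} {y} x∼y)
  Close⇒VDEquiv (suc k) x y = finite (between? (proj₁ x) (proj₁ y)) (λ _ → proj₁)
    (λ z → mk⇔ (between⇒ {x} {y} {z}) (⇒between {x} {y} {z})) (Close⇒VDEquiv k)

  -- Counting elements of small norm

  infix 4 _≼_

  _≼_ : Element → Element → Set (ℓ ⊔ ℓ′)
  x ≼ y = ⟨ x ⟩ ≺ ⟨ y ⟩ ⊎ ⟨ x ⟩ ≡ ⟨ y ⟩

  ≺-≼-trans : ∀ {l} → l ≺ ⟨ x ⟩ → x ≼ y → l ≺ ⟨ y ⟩
  ≺-≼-trans l≺x (inj₁ x≺y) = ≺.trans l≺x x≺y
  ≺-≼-trans l≺x (inj₂ x≡y) = subst (_ ≺_) x≡y l≺x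

  Ascending : List Element → Set ℓ′
  Ascending = AllPairs (λ x y → ⟨ x ⟩ ≺ ⟨ y ⟩)

  Apart : ℕ → List Element → Set
  Apart k = AllPairs (λ x y → ¬ Close k (proj₁ x) (proj₁ y))

  -- Sorting yields a weakly ascending list; it is strict because equal elements are `Close`.
  -- Apartness survives the permutation since `Close` is symmetric.
  sort-apart : ∀ k cs → Apart k cs → ∃ λ ds → ds ↭ cs × Ascending ds × Apart k ds
  sort-apart k cs apart = sort cs , sort-↭ cs ,
    AllPairs.zipWith (λ { {x} {y} (inj₁ x≺y , _) → x≺y ; {x} {y} (inj₂ x≡y , ¬c) → contradiction (Close-reflexive k x y x≡y) ¬c })
      (Linked⇒AllPairs (λ {x} {y} {z} → Order.trans {x} {y} {z}) (sort-↗ cs) , apart′) ,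
    apart′
    where
    order : DecTotalOrder _ _ _
    order = On.decTotalOrder (StrictTotalOrderₚ.decTotalOrder (record { isStrictTotalOrder = isStrictTotalOrder })) ⟨_⟩
    module Order = DecTotalOrder order
    open Data.List.Sort order using (sort; sort-↭; sort-↗)
    apart′ : Apart k (sort cs)
    apart′ = AllPairs-resp-↭ (setoid Element) (λ {x} {y} ¬c c → ¬c (Close-sym k y x c)) (resp₂ _) (↭⇒↭ₛ (↭-sym (sort-↭ cs))) apart

  -- Sorted, consecutive members of cs bound disjoint half-open intervals, each of which contributes G elements.
  chain : ∀ k {G S} {P : Element → Set} →
    (∀ x y → ⟨ x ⟩ ≺ ⟨ y ⟩ → ¬ Close k (proj₁ x) (proj₁ y) → P x → P y →
      ∃ λ zs → List.length zs ≡ G × Ascending zs × All (λ z → x ≼ z × ⟨ z ⟩ ≺ ⟨ y ⟩ × norm z ≤ S) zs) →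
    ∀ c cs → Ascending (c ∷ cs) → Apart k (c ∷ cs) → All P (c ∷ cs) →
    ∃ λ zs → List.length zs ≡ List.length cs * G × Ascending zs ×
      All (λ z → c ≼ z × (∃₂ λ (x y : Element) → P x × P y × x ≼ z × ⟨ z ⟩ ≺ ⟨ y ⟩) × norm z ≤ S) zs
  chain k fill c [] _ _ _ = [] , refl , [] , []
  chain k fill c (d ∷ cs) ((c≺d ∷ _) ∷ asc) ((c≁d ∷ _) ∷ apart) (Pc ∷ Pd ∷ Ps)
    with ws , ∣ws∣ , ws-asc , ws-in ← fill c d c≺d c≁d Pc Pd | zs , ∣zs∣ , zs-asc , zs-in ← chain k fill d cs asc apart (Pd ∷ Ps) =
    ws List.++ zs ,
    trans (Listₚ.length-++ ws) (cong₂ _+_ ∣ws∣ ∣zs∣) ,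
    -- All of ws lies strictly below d, and all of zs at or above d.
    AllPairsₚ.++⁺ ws-asc zs-asc (All.map (λ {w} (_ , w≺d , _) →
      All.map (λ {z} (d≼z , _) → ≺-≼-trans {d} {z} w≺d d≼z) zs-in) ws-in) ,
    Allₚ.++⁺ (All.map (λ {w} (c≼w , w≺d , w≤) → c≼w , (c , d , Pc , Pd , c≼w , w≺d) , w≤) ws-in)
             (All.map (λ {z} (d≼z , rest) → inj₁ (≺-≼-trans {d} {z} c≺d d≼z) , rest) zs-in)

  lift-to-elements : {P : List (Vec ℕ m) → Set} → ∀ cs → All (Sat D) cs → P cs → ∃ λ (es : List Element) → P (List.map proj₁ es)
  lift-to-elements         []       []       p = [] , p
  lift-to-elements {P = P} (c ∷ cs) (d ∷ ds) p = let es , q = lift-to-elements {P = λ cs → P (c ∷ cs)} cs ds p in (c , d) ∷ es , q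

  -- The induction hypothesis on k. It matters that C is chosen before x, y and N: the next level
  -- applies it to ends whose norms grow with N.
  Many : ℕ → Set (ℓ ⊔ ℓ′)
  Many k = ∃ λ C → ∀ x y → ⟨ x ⟩ ≺ ⟨ y ⟩ → ¬ Close k (proj₁ x) (proj₁ y) → ∀ N →
    ∃ λ zs → List.length zs ≡ N ^ k × Ascending zs ×
      All (λ z → x ≼ z × ⟨ z ⟩ ≺ ⟨ y ⟩ × norm z ≤ C * suc (N + (norm x + norm y))) zs

  -- The elements found are only enclosed by members of Q. When Q is an interval, convexity puts
  -- them inside it.
  Rungs : ℕ → (Vec ℕ m → Set) → ℕ → ℕ → Set (ℓ ⊔ ℓ′)
  Rungs k Q N S = ∃ λ zs → List.length zs ≡ N ^ suc k × Ascending zs ×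
    All (λ z → (∃₂ λ (x y : Element) → Q (proj₁ x) × Q (proj₁ y) × x ≼ z × ⟨ z ⟩ ≺ ⟨ y ⟩) × norm z ≤ S) zs

  Ladder : ℕ → (Vec ℕ m → Vec ℕ n → Set) → Set (ℓ ⊔ ℓ′)
  Ladder k Q = ∃ λ C → ∀ ρ → ¬ FinitelyCovered (λ c → Q c ρ) (Close k) → ∀ N →
    Rungs k (λ c → Q c ρ) N (C * suc (N + sum ρ))

  -- Sorted, N + 1 pairwise non-close representatives leave N gaps, and `Many k` places N ^ k
  -- elements in each. The ends of the gaps have norm linear in N + sum ρ, hence so do these
  -- elements.
  ladder : ∀ k → Many k → {Q : Vec ℕ m → Vec ℕ n → Set} → Tame₂ Q → (∀ {c ρ} → Q c ρ → Sat D c) → Ladder k Q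
  ladder {n} k (C , many) {Q} Q-tame Q⊆D = ladder′ (representatives Q-tame (Close-tame k)
      (λ {_} {c} q → Close-reflexive k (c , Q⊆D q) (c , Q⊆D q) refl)
      (λ {_} {a} {b} {c} p q r → Close-trans k (a , Q⊆D p) (b , Q⊆D q) (c , Q⊆D r)))
    where
    spacing : ℕ → ℕ → ℕ → ℕ
    spacing B N s = B * suc s + suc N * B
    size : ∀ B N s → C * suc (N + (spacing B N s + spacing B N s)) ≤ C * suc (B * 4) * suc (N + s)
    size B N s = begin
      C * suc (N + (spacing B N s + spacing B N s))     ≤⟨ ℕₚ.*-monoʳ-≤ C (ℕₚ.m≤m+n _ excess) ⟩
      C * (suc (N + (spacing B N s + spacing B N s)) + excess)  ≡⟨ cong (C *_) (identity B N s) ⟩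
      C * (suc (B * 4) * suc (N + s))                   ≡⟨ ℕₚ.*-assoc C (suc (B * 4)) (suc (N + s)) ⟨
      C * suc (B * 4) * suc (N + s)                     ∎
      where
      open ℕₚ.≤-Reasoning
      -- The exact difference of the two sides, which turns the inequality into a polynomial
      -- identity.
      excess = s + (B * N + (B * N + (B * s + B * s)))
      identity : ∀ B N s → suc (N + ((B * suc s + suc N * B) + (B * suc s + suc N * B)))
        + (s + (B * N + (B * N + (B * s + B * s)))) ≡ suc (B * 4) * suc (N + s)
      identity = ℕ-Solver.solve-∀
    ladder′ : (∃ λ B → ∀ ρ → ¬ FinitelyCovered (λ c → Q c ρ) (Close k) → ∀ N → ∃ λ cs → List.length cs ≡ N ×
        All (λ c → Q c ρ × sum c ≤ B * suc (sum ρ) + N * B) cs × AllPairs (λ c c′ → ¬ Close k c c′) cs) → _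
    ladder′ (B , reps) = C * suc (B * 4) , λ ρ ¬fin N → build ρ N (reps ρ ¬fin (suc N))
      where
      T : Vec ℕ n → ℕ → ℕ
      T ρ N = spacing B N (sum ρ)
      fill : ∀ ρ N x y → ⟨ x ⟩ ≺ ⟨ y ⟩ → ¬ Close k (proj₁ x) (proj₁ y) →
        Q (proj₁ x) ρ × norm x ≤ T ρ N → Q (proj₁ y) ρ × norm y ≤ T ρ N →
        ∃ λ zs → List.length zs ≡ N ^ k × Ascending zs ×
          All (λ z → x ≼ z × ⟨ z ⟩ ≺ ⟨ y ⟩ × norm z ≤ C * suc (N + (T ρ N + T ρ N))) zs
      fill ρ N x y x≺y x≁y (_ , x≤) (_ , y≤) = let zs , ∣zs∣ , asc , zs-in = many x y x≺y x≁y N in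
        zs , ∣zs∣ , asc , All.map (λ (x≼z , z≺y , z≤) → x≼z , z≺y ,
          ℕₚ.≤-trans z≤ (ℕₚ.*-monoʳ-≤ C (s≤s (ℕₚ.+-monoʳ-≤ N (ℕₚ.+-mono-≤ x≤ y≤))))) zs-in
      build : ∀ ρ N → (∃ λ cs → List.length cs ≡ suc N ×
          All (λ c → Q c ρ × sum c ≤ B * suc (sum ρ) + suc N * B) cs × AllPairs (λ c c′ → ¬ Close k c c′) cs) →
        Rungs k (λ c → Q c ρ) N (C * suc (B * 4) * suc (N + sum ρ))
      build ρ N (cs , ∣cs∣ , cs-in , cs-apart) with es , ∣es∣ , es-in , es-apart ← lift-to-elements
          {P = λ cs → List.length cs ≡ suc N × All (λ c → Q c ρ × sum c ≤ T ρ N) cs × AllPairs (λ c c′ → ¬ Close k c c′) cs}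
          cs (All.map (λ (q , _) → Q⊆D q) cs-in) (∣cs∣ , cs-in , cs-apart)
        with sort-apart k es (AllPairsₚ.map⁻ es-apart)
      ... | [] , ds↭es , _ , _ = contradiction (trans (↭-length ds↭es) (trans (sym (Listₚ.length-map proj₁ es)) ∣es∣)) λ ()
      ... | d ∷ ds , ds↭es , asc , apart
        with zs , ∣zs∣ , zs-asc , zs-in ← chain k (fill ρ N) d ds asc apart (All-resp-↭ (↭-sym ds↭es) (Allₚ.map⁻ es-in)) =
        zs ,
        trans ∣zs∣ (cong (_* N ^ k) (ℕₚ.suc-injective (trans (↭-length ds↭es) (trans (sym (Listₚ.length-map proj₁ es)) ∣es∣)))) ,
        zs-asc ,
        All.map (λ (_ , (x , y , (qx , _) , (qy , _) , x≼z , z≺y) , z≤) →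
          (x , y , qx , qy , x≼z , z≺y) , ℕₚ.≤-trans z≤ (size B N (sum ρ))) zs-in

  many : ∀ k → Many k
  -- Since N ^ 0 = 1, the closed lower end x suffices.
  many zero = 1 , λ x y x≺y _ N → x ∷ [] , refl , [] ∷ [] ,
    (inj₂ refl , x≺y , ℕₚ.≤-trans (ℕₚ.m≤m+n (norm x) (norm y))
      (ℕₚ.≤-trans (ℕₚ.m≤n+m _ (suc N)) (ℕₚ.≤-reflexive (sym (ℕₚ.*-identityˡ _))))) ∷ []
  many (suc k) = many′ (ladder k (many k) Between-tame proj₁)
    where
    many′ : Ladder k BetweenEnds → Many (suc k)
    many′ (C , rungs) = C , λ x y x≺y x≁y N →
      let e , e′ = take-drop-++ m (proj₁ x) (proj₁ y)
          ρ = proj₁ x ++ proj₁ y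
          zs , ∣zs∣ , asc , zs-in = rungs ρ (x≁y ∘ subst₂ (λ a b → FinitelyCovered (Between a b) (Close k)) e e′) N
          between : ∀ w → BetweenEnds (proj₁ w) ρ → ⟨ x ⟩ ≺ ⟨ w ⟩ × ⟨ w ⟩ ≺ ⟨ y ⟩
          between w = inside x≺y ∘ between⇒ {x} {y} {w} ∘ subst₂ (λ a b → Between a b (proj₁ w)) e e′
      -- Here u and v lie in the open interval, so x ≺ u ≼ z ≺ v ≺ y.
      in zs , ∣zs∣ , asc , All.map (λ {z} ((u , v , u-in , v-in , u≼z , z≺v) , z≤) →
           inj₁ (≺-≼-trans {u} {z} (proj₁ (between u u-in)) u≼z) , ≺.trans z≺v (proj₂ (between v v-in)) ,
           subst (λ s → norm z ≤ C * suc (N + s)) (sum-++ (proj₁ x) (proj₁ y)) z≤) zs-in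
      where
      inside : ∀ {a b c} → a ≺ b → StrictlyBetween _≺_ a b c → a ≺ c × c ≺ b
      inside a≺b (inj₁ p)           = p
      inside a≺b (inj₂ (b≺c , c≺a)) = contradiction a≺b (≺.asym (≺.trans b≺c c≺a))

  -- Strictly ascending elements come from distinct tuples, all in a box with (N + 1) ^ m points.
  ascending-length : ∀ {N} zs → Ascending zs → All (λ z → norm z ≤ N) zs → List.length zs ≤ suc N ^ m
  ascending-length {N} zs asc zs≤N = subst (List.length zs ≤_)
    (trans (length-vectors (upTo (suc N)) m) (cong (_^ m) (Listₚ.length-upTo (suc N))))
    (length-≤ proj₁ (AllPairs.map (λ { {a , d} {b , e} x≺y refl → ≺.irrefl (∼⇒≡ {a , d} {a , e} (E-refl a d)) x≺y }) asc)
      (All.map (λ {z} → ∈-box (proj₁ z)) zs≤N))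

  covered : FinitelyCovered (Sat D) (Close m)
  covered = decidable-stable (P? (Tame-FinitelyCovered {n = 0} {Q = λ c _ → Sat D c} (λ c-linear _ → D-tame c-linear) (Close-tame m)) [])
    λ ¬fin → let C , rungs = ladder m (many m) {Q = λ c (_ : Vec ℕ 0) → Sat D c} (λ c-linear _ → D-tame c-linear) (λ d → d)
                 -- For N = G + 1 the norms are at most C * (N + 1), and C * (N + 1) + 1 ≤ (2 * C +
                 -- 1) * N. Hence N ^ (m + 1) ≤ G * N ^ m, and cancelling gives N ≤ G.
                 G = suc (C + C) ^ m
                 zs , ∣zs∣ , asc , zs-in = rungs [] ¬fin (suc G)
             in ℕₚ.n≮n G (ℕₚ.*-cancelʳ-≤ (suc G) G (suc G ^ m) {{ℕₚ.m^n≢0 (suc G) m}} (begin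
                  suc G ^ suc m                          ≡⟨ ∣zs∣ ⟨
                  List.length zs                         ≤⟨ ascending-length zs asc (All.map proj₂ zs-in) ⟩
                  suc (C * suc (suc G + 0)) ^ m          ≤⟨ ℕₚ.^-monoˡ-≤ m (ℕₚ.≤-trans (ℕₚ.m≤m+n _ (G + C * G)) (ℕₚ.≤-reflexive (size C G))) ⟩
                  (suc (C + C) * suc G) ^ m              ≡⟨ ^-distribʳ-* m (suc (C + C)) (suc G) ⟩
                  G * suc G ^ m                          ∎))
    where
    open ℕₚ.≤-Reasoning
    size : ∀ C G → suc (C * suc (suc G + 0)) + (G + C * G) ≡ suc (C + C) * suc G
    size = ℕ-Solver.solve-∀

theorem3 : ∀ {ℓ ℓ' : Level} (m : ℕ) → 1 ≤ m →
    (L : Set ℓ) (_≺_ : Rel L ℓ') → IsStrictTotalOrder _≡_ _≺_ →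
    Interpretation L _≺_ m → VDRankAtMost _≺_ m
theorem3 m _ L _≺_ isStrictTotalOrder interpretation = m , ℕₚ.≤-refl ,
  finite (P? (Tame-Sat D)) (λ _ d → d) (λ x → mk⇔ (λ _ → _) (λ _ → proj₂ x)) (Close⇒VDEquiv m) covered
  where
  open Interpretation interpretation
  open Ranks isStrictTotalOrder interpretation
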